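{- Let $k\ge 3$ be an integer and let $G$ be a finite group of odd order. Then there are infinitely many integers $v$ for which there exists a $2$-$(v,k,1)$-design whose automorphism group has a subgroup isomorphic to $G$.
   Context: A $2$-$(v,k,1)$-design consists of a set of $v$ points together with a collection of $k$-element subsets of the points (called blocks) such that any two distinct points lie in exactly one block. An automorphism is a permutation of the points mapping the set of blocks onto itself. -}

module Defs where

open import Data.Nat using (ℕ; _≥_)
open import Data.Nat.Divisibility using (_∣_)
open import Data.Fin using (Fin)
open import Data.Fin.Subset using (Subset; _∈_; ∣_∣)
open import Data.Fin.Permutation using (Permutation′; _⟨$⟩ʳ_; _⟨$⟩ˡ_)
open import Data.Vec using (tabulate; lookup)
open import Data.Product using (Σ; _×_; ∃)
open import Relation.Nullary using (¬_)
open import Relation.Binary.PropositionalEquality using (_≡_; _≢_)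

-- A finite group of order n, presented on the carrier Fin n
-- (every finite group is isomorphic to one of these).
record FiniteGroup : Set where
  field
    order : ℕ
    _·_   : Fin order → Fin order → Fin order
    e     : Fin order
    inv   : Fin order → Fin order
    assoc : ∀ x y z → (x · y) · z ≡ x · (y · z)
    idˡ   : ∀ x → e · x ≡ x
    idʳ   : ∀ x → x · e ≡ x
    invˡ  : ∀ x → inv x · x ≡ e
    invʳ  : ∀ x → x · inv x ≡ e

record Design (v k : ℕ) : Set where
  field
    b          : ℕ
    block      : Fin b → Subset v
    block-size : ∀ i → ∣ block i ∣ ≡ k
    block-inj  : ∀ i j → block i ≡ block j → i ≡ j
    pair-unique : ∀ (x y : Fin v) → x ≢ y →
      Σ (Fin b) λ i → (x ∈ block i) × (y ∈ block i) ×
        (∀ j → x ∈ block j → y ∈ block j → j ≡ i)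

image : ∀ {v} → Permutation′ v → Subset v → Subset v
image σ B = tabulate λ y → lookup B (σ ⟨$⟩ˡ y)

IsAutomorphism : ∀ {v k} → Design v k → Permutation′ v → Set
IsAutomorphism D σ =
  (∀ i → ∃ λ j → image σ (block i) ≡ block j) ×
  (∀ j → ∃ λ i → image σ (block i) ≡ block j)
  where open Design D

HasSubgroupIso : ∀ {v k} → Design v k → FiniteGroup → Set
HasSubgroupIso {v} D G =
  Σ (Fin order → Permutation′ v) λ φ →
    (∀ g → IsAutomorphism D (φ g)) ×
    (∀ g h (x : Fin v) → φ (g · h) ⟨$⟩ʳ x ≡ φ g ⟨$⟩ʳ (φ h ⟨$⟩ʳ x)) ×
    (∀ g h → (∀ (x : Fin v) → φ g ⟨$⟩ʳ x ≡ φ h ⟨$⟩ʳ x) → g ≡ h)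
  where open FiniteGroup G

OddOrder : FiniteGroup → Set
OddOrder G = ¬ (2 ∣ FiniteGroup.order G)

module Submission where

-- Let n be the order of G and index the two-element subsets of Fin k by m classes.
-- Take a large prime p congruent to 1 modulo 2 m n, put e = (p - 1) / m, and let G permute
-- the coordinates of V = F_p ^ n. The blocks are the sets { t + b_i x : i in Fin k } with
-- t in V and x in T, where the differences b_i - b_j (i < j) have e-th powers running once
-- through the m-th roots of unity, and T is G-invariant and such that every nonzero vector
-- is uniquely of the form (b_i - b_j) x with i /= j and x in T.
--
-- The prime comes from an inclusion-exclusion product of the numbers b ^ (M / d) - 1. The
-- b_i are chosen one at a time: a second moment estimate shows that for all but boundedly
-- many b the translated class b + C meets a given large set in its fair share.
-- For T, let psi x be the product over h in G of the first nonzero coordinate of h x. It is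
-- G-invariant, satisfies psi (c x) = c ^ n psi x, and is odd since n is odd; T is cut out
-- by normalising psi ^ (e / n) up to m-th roots of unity and psi up to sign.

-- The obstacle is the sign. Exchanging `i` and `j` negates `b i - b j`, and as e is even both
-- differences lie in the same class, so the m = k (k - 1) / 2 classes cannot separate (b_i - b_j) x
-- from (b_j - b_i) (- x). A second invariant has to choose between x and - x, and it must respect
-- G. If G contained an involution g, some nonzero y would satisfy g y = - y, and an invariant T
-- would represent - y twice, once with (i, j) and once with (j, i). For n odd, psi is odd and makes
-- the choice.
--
-- Each factor of the modulus 2 m n has its task: m yields the classes, n makes psi ^ (e / n)
-- available, which scales by exactly c ^ e, and 2 makes e even. The coordinates are indexed by G
-- itself, so G acts by its regular representation, which is faithful.
--
-- The inclusion-exclusion product is the value at b of the M-th cyclotomic polynomial. A prime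
-- modulo which b has order M satisfies M | p - 1 by Fermat.

-- Primes congruent to 1 modulo M, from values of cyclotomic polynomials.

module PrimesInProgressions where

  open import Data.Nat
  open import Data.Nat.Properties
  open import Data.Nat.Divisibility
  open import Data.Nat.DivMod using (_%_; %-distribˡ-*; %-distribˡ-+; [m+kn]%n≡m%n)
  open import Data.Nat.GCD using (gcd; gcd[m,n]∣m; gcd[m,n]∣n; gcd-GCD; GCD; module Bézout; gcd[m,n]≢0; gcd-greatest; c*gcd[m,n]≡gcd[cm,cn])
  open import Data.Nat.Induction using (<-rec)
  open import Data.Nat.Primality
  open import Data.Nat.Primality.Factorisation using (factorise)
  open import Data.Nat.ListAction using (product)
  open import Data.Nat.Tactic.RingSolver using (solve-∀)
  open import Data.List using (List; []; _∷_)
  open import Data.List.Membership.Propositional using (_∈_)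
  open import Data.List.Membership.DecPropositional _≟_ using (_∈?_)
  open import Data.List.Relation.Unary.Any using (here; there)
  open import Data.List.Relation.Unary.All using (All; []; _∷_)
  open import Data.List.Relation.Unary.All.Properties using (¬Any⇒All¬; All¬⇒¬Any)
  open import Data.List.Relation.Unary.Unique.Propositional using (Unique; []; _∷_)
  open import Data.Product using (∃; _×_; _,_; proj₁; proj₂)
  open import Data.Sum using (_⊎_; inj₁; inj₂)
  open import Data.Empty using (⊥; ⊥-elim)
  open import Relation.Nullary using (¬_; yes; no)
  open import Relation.Binary.PropositionalEquality

  prime≢1 : ∀ {p} → Prime p → p ≢ 1
  prime≢1 pp refl = ¬prime[1] pp

  ∃-prime-divisor : ∀ n → 1 < n → ∃ λ p → Prime p × p ∣ n
  ∃-prime-divisor n@(suc _) 1<n with factorise n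
  ... | record { factors = [] ; isFactorisation = eq } = ⊥-elim (<⇒≢ 1<n (sym eq))
  ... | record { factors = p ∷ ps ; isFactorisation = eq ; factorsPrime = pp ∷ _ } =
    p , pp , subst (p ∣_) (sym eq) (m∣m*n (product ps))

  prime-∣⇒≡ : ∀ {p q} → Prime p → Prime q → p ∣ q → p ≡ q
  prime-∣⇒≡ pp pq p∣q with prime⇒irreducible pq p∣q
  ... | inj₁ p≡1 = ⊥-elim (prime≢1 pp p≡1)
  ... | inj₂ p≡q = p≡q

  -- For prime `p` this says that `u` is the `p`-adic valuation of `x`, as a relation carrying its
  -- cofactor.
  record Part (p x u : ℕ) : Set where
    constructor part
    field
      cofactor : ℕ
      factors  : x ≡ p ^ u * cofactor
      p∤       : ¬ (p ∣ cofactor)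

  part-0 : ∀ {p x} → ¬ (p ∣ x) → Part p x 0
  part-0 {x = x} h = part x (sym (+-identityʳ x)) h

  part-* : ∀ {p x y u v} → Prime p → Part p x u → Part p y v → Part p (x * y) (u + v)
  part-* {p} {x} {y} {u} {v} pp (part s refl ps) (part t refl pt) = part (s * t) eq λ d → case-⊎ (euclidsLemma s t pp d)
    where
    case-⊎ : p ∣ s ⊎ p ∣ t → ⊥
    case-⊎ (inj₁ d) = ps d
    case-⊎ (inj₂ d) = pt d
    open ≡-Reasoning
    shuffle : ∀ a b c d → a * b * (c * d) ≡ a * c * (b * d)
    shuffle = solve-∀
    eq : p ^ u * s * (p ^ v * t) ≡ p ^ (u + v) * (s * t)
    eq = begin
      p ^ u * s * (p ^ v * t)   ≡⟨ shuffle (p ^ u) s (p ^ v) t ⟩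
      p ^ u * p ^ v * (s * t)   ≡⟨ cong (_* (s * t)) (^-distribˡ-+-* p u v) ⟨
      p ^ (u + v) * (s * t)     ∎

  part-unique : ∀ {p x u v} → Prime p → Part p x u → Part p x v → u ≡ v
  part-unique {p} pp (part s e ps) (part t f pt) = go _ _ (trans (sym e) f)
    where
    instance _ = prime⇒nonZero pp
    p∣ : ∀ w z → p ∣ p ^ suc w * z
    p∣ w z = ∣m⇒∣m*n z (m∣m*n (p ^ w))
    go : ∀ u v → p ^ u * s ≡ p ^ v * t → u ≡ v
    go zero zero eq = refl
    go zero (suc v) eq = ⊥-elim (ps (subst (p ∣_) (trans (sym eq) (*-identityˡ s)) (p∣ v t)))
    go (suc u) zero eq = ⊥-elim (pt (subst (p ∣_) (trans eq (*-identityˡ t)) (p∣ u s)))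
    go (suc u) (suc v) eq = cong suc (go u v (*-cancelˡ-≡ _ _ p
      (trans (sym (*-assoc p (p ^ u) s)) (trans eq (*-assoc p (p ^ v) t)))))

  ∃-part : ∀ {p} → Prime p → ∀ x → .{{NonZero x}} → ∃ λ u → Part p x u
  ∃-part {p} pp x {{x≢0}} = <-rec (λ x → .(NonZero x) → ∃ λ u → Part p x u) step x x≢0
    where
    step : ∀ x → (∀ {y} → y < x → .(NonZero y) → ∃ λ u → Part p y u) → .(NonZero x) → ∃ λ u → Part p x u
    step x rec x≢0 with p ∣? x
    ... | no ¬d = 0 , part-0 ¬d
    ... | yes d with rec (quotient-< d {{prime⇒nonTrivial pp}} {{x≢0}}) (quotient≢0 d {{x≢0}})
    ...   | u , part y e py = suc u , part y (trans (m∣n⇒n≡m*quotient d) (trans (cong (p *_) e) (sym (*-assoc p (p ^ u) y)))) py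

  coprime⇒different-part : ∀ g z w → g ≢ 0 → 1 < z → (∀ {p} → Prime p → p ∣ z → p ∣ w → ⊥) →
    ∃ λ p → Prime p × ∀ u → Part p (g * z) u → Part p (g * w) u → ⊥
  coprime⇒different-part g z w g≢0 1<z cop with ∃-prime-divisor z 1<z
  ... | p , pp , d with ∃-part pp g {{≢-nonZero g≢0}} | ∃-part pp z {{>-nonZero (<-trans z<s 1<z)}}
  ...   | a , pa | c , pc = p , pp , contra
    where
    contra : ∀ u → Part p (g * z) u → Part p (g * w) u → ⊥
    contra u pz pw with part-unique pp pw (part-* pp pa (part-0 (cop pp d)))
    ... | u≡a with +-cancelˡ-≡ a c 0 (trans (sym (part-unique pp pz (part-* pp pa pc))) u≡a)
    ...   | refl = Part.p∤ pc (subst (p ∣_) (trans (Part.factors pc) (*-identityˡ _)) d)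

  gcd-cofactors-coprime : ∀ {x y} g x′ y′ → g ≡ gcd x y → g ≢ 0 → x ≡ g * x′ → y ≡ g * y′ →
    ∀ {p} → Prime p → p ∣ x′ → p ∣ y′ → ⊥
  gcd-cofactors-coprime g x′ y′ g≡ g≢0 refl refl {p} pp d d′ = prime≢1 pp (∣1⇒≡1 (*-cancelˡ-∣ g {{≢-nonZero g≢0}}
    (subst₂ _∣_ refl (trans (sym g≡) (sym (*-identityʳ g))) (gcd-greatest (*-monoʳ-∣ g d) (*-monoʳ-∣ g d′)))))

  -- Divided by their gcd, the two numbers become coprime and are not both 1. A prime divisor of one
  -- cofactor misses the other, so it raises the valuation on one side only.
  ≢⇒∃-different-part : ∀ x y → .{{NonZero x}} → .{{NonZero y}} → x ≢ y →
    ∃ λ p → Prime p × ∀ u → Part p x u → Part p y u → ⊥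
  ≢⇒∃-different-part x y x≢y = go (gcd x y) refl (gcd[m,n]≢0 x y (inj₁ (≢-nonZero⁻¹ x)))
    (m∣n⇒n≡m*quotient (gcd[m,n]∣m x y)) (m∣n⇒n≡m*quotient (gcd[m,n]∣n x y))
    (>-nonZero⁻¹ _ {{quotient≢0 (gcd[m,n]∣m x y)}}) (>-nonZero⁻¹ _ {{quotient≢0 (gcd[m,n]∣n x y)}})
    where
    Goal : Set
    Goal = ∃ λ p → Prime p × ∀ u → Part p x u → Part p y u → ⊥
    go : ∀ g → g ≡ gcd x y → g ≢ 0 → ∀ {x′ y′} → x ≡ g * x′ → y ≡ g * y′ → 0 < x′ → 0 < y′ → Goal
    go g g≡ g≢0 {x′} {y′} ex ey 0<x′ 0<y′ with 1 <? x′ | 1 <? y′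
    ... | yes 1<x′ | _ = subst₂ (λ x y → ∃ λ p → Prime p × ∀ u → Part p x u → Part p y u → ⊥) (sym ex) (sym ey)
      (coprime⇒different-part g x′ y′ g≢0 1<x′ (gcd-cofactors-coprime g x′ y′ g≡ g≢0 ex ey))
    ... | no _ | yes 1<y′ = swap (subst₂ (λ y x → ∃ λ p → Prime p × ∀ u → Part p y u → Part p x u → ⊥) (sym ey) (sym ex)
      (coprime⇒different-part g y′ x′ g≢0 1<y′ (λ pp d d′ → gcd-cofactors-coprime g x′ y′ g≡ g≢0 ex ey pp d′ d)))
      where
      swap : (∃ λ p → Prime p × ∀ u → Part p y u → Part p x u → ⊥) → Goal
      swap (p , pp , h) = p , pp , λ u a b → h u b a
    ... | no 1≮x′ | no 1≮y′ = ⊥-elim (x≢y (trans ex (trans (cong (g *_)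
      (trans (≤-antisym (≮⇒≥ 1≮x′) 0<x′) (sym (≤-antisym (≮⇒≥ 1≮y′) 0<y′)))) (sym ey))))

  -- Only squarefree divisors have nonzero Möbius value, so the product to come runs over the
  -- subsets of `S`. The number `c` is the smallest exponent that occurs in it.
  squarefree-kernel : ∀ M → .{{NonZero M}} → ∃ λ c → ∃ λ S →
    c * product S ≡ M × All Prime S × Unique S × (∀ ℓ → Prime ℓ → ℓ ∣ M → ℓ ∈ S)
  squarefree-kernel M with factorise M
  ... | record { factors = fs ; isFactorisation = refl ; factorsPrime = pfs } = go fs pfs
    where
    go : ∀ fs → All Prime fs → ∃ λ c → ∃ λ S →
      c * product S ≡ product fs × All Prime S × Unique S × (∀ ℓ → Prime ℓ → ℓ ∣ product fs → ℓ ∈ S)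
    go [] [] = 1 , [] , refl , [] , [] , λ ℓ pℓ d → ⊥-elim (prime≢1 pℓ (∣1⇒≡1 d))
    go (f ∷ fs) (pf ∷ pfs) with go fs pfs
    ... | c , S , e , pS , uS , h with f ∈? S
    ...   | yes f∈S = f * c , S , trans (*-assoc f c (product S)) (cong (f *_) e) , pS , uS , h′
      where
      h′ : ∀ ℓ → Prime ℓ → ℓ ∣ f * product fs → ℓ ∈ S
      h′ ℓ pℓ d with euclidsLemma f (product fs) pℓ d
      ... | inj₁ d₁ = subst (_∈ S) (sym (prime-∣⇒≡ pℓ pf d₁)) f∈S
      ... | inj₂ d₂ = h ℓ pℓ d₂
    ...   | no f∉S = c , f ∷ S , trans (shuffle c f (product S)) (cong (f *_) e) , pf ∷ pS , ¬Any⇒All¬ S f∉S ∷ uS , h′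
      where
      shuffle : ∀ c f s → c * (f * s) ≡ f * (c * s)
      shuffle = solve-∀
      h′ : ∀ ℓ → Prime ℓ → ℓ ∣ f * product fs → ℓ ∈ f ∷ S
      h′ ℓ pℓ d with euclidsLemma f (product fs) pℓ d
      ... | inj₁ d₁ = here (prime-∣⇒≡ pℓ pf d₁)
      ... | inj₂ d₂ = there (h ℓ pℓ d₂)

  module PowersMinusOne (b : ℕ) (3≤b : 3 ≤ b) where

    instance
      b≢0 : NonZero b
      b≢0 = >-nonZero (≤-trans z<s 3≤b)

    F : ℕ → ℕ
    F n = pred (b ^ n)

    suc-F : ∀ n → suc (F n) ≡ b ^ n
    suc-F n = suc-pred (b ^ n) {{m^n≢0 b n}}

    F-+ : ∀ m n → F (m + n) ≡ F n + F m * suc (F n)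
    F-+ m n = suc-injective (begin
      suc (F (m + n))          ≡⟨ suc-F (m + n) ⟩
      b ^ (m + n)              ≡⟨ ^-distribˡ-+-* b m n ⟩
      b ^ m * b ^ n            ≡⟨ cong₂ _*_ (suc-F m) (suc-F n) ⟨
      suc (F m) * suc (F n)    ∎)
      where open ≡-Reasoning

    1<F : ∀ n → .{{NonZero n}} → 1 < F n
    1<F n = ≤-pred (subst (3 ≤_) (sym (suc-F n)) (≤-trans 3≤b (subst (_≤ b ^ n) (*-identityʳ b) (^-monoʳ-≤ b (>-nonZero⁻¹ n)))))

    F-∣ : ∀ {p} n t → p ∣ F n → p ∣ F (t * n)
    F-∣ n zero d = _ ∣0
    F-∣ {p} n (suc t) d = subst (p ∣_) (sym (F-+ n (t * n))) (∣m∣n⇒∣m+n (F-∣ n t d) (∣m⇒∣m*n _ d))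

    F-∣-∸ : ∀ {p} m n → p ∣ F (m + n) → p ∣ F n → p ∣ F m
    F-∣-∸ {p} m n d d′ = ∣m+n∣m⇒∣n (subst (p ∣_) (rearrange (F n) (F m)) (subst (p ∣_) (F-+ m n) d))
      (∣m∣n⇒∣m+n d′ (∣n⇒∣m*n (F m) d′))
      where
      rearrange : ∀ x y → x + y * suc x ≡ (x + y * x) + y
      rearrange = solve-∀

    -- The exponents `n` with `p ∣ F n` are closed under multiples and differences; Bézout's
    -- identity writes the gcd as a difference of multiples.
    F-gcd : ∀ {p} m n → p ∣ F m → p ∣ F n → p ∣ F (gcd m n)
    F-gcd {p} m n d d′ with Bézout.identity (gcd-GCD m n)
    ... | Bézout.+- x y eq = F-∣-∸ (gcd m n) (y * n) (subst (λ z → p ∣ F z) (sym eq) (F-∣ m x d)) (F-∣ n y d′)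
    ... | Bézout.-+ x y eq = F-∣-∸ (gcd m n) (x * m) (subst (λ z → p ∣ F z) (sym eq) (F-∣ n y d′)) (F-∣ m x d)

    F∣⇒∤b : ∀ {p} n → .{{NonZero n}} → Prime p → p ∣ F n → ¬ (p ∣ b)
    F∣⇒∤b {p} n@(suc n′) pp d d′ = prime≢1 pp (∣1⇒≡1 (∣m+n∣m⇒∣n
      (subst (p ∣_) (trans (sym (suc-F n)) (+-comm 1 (F n))) (∣m⇒∣m*n (b ^ n′) d′)) d))

    -- The factor `s` is the geometric sum of the `t` powers `b ^ (n * i)` with `i < t`. Each of
    -- them is 1 modulo `p`, hence `s` is `t` modulo `p`.
    F-quotient : ∀ n t f p → F n ≡ p * f → ∃ λ s → ∃ λ u → F (t * n) ≡ F n * s × s ≡ t + p * u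
    F-quotient n zero f p e = 0 , 0 , sym (*-zeroʳ (F n)) , sym (*-zeroʳ p)
    F-quotient n (suc t) f p e with F-quotient n t f p e
    ... | s , u , e₁ , e₂ = suc (s + F n * s) , (u + f * (t + p * u)) ,
        trans (F-+ n (t * n)) (trans (cong (λ z → z + F n * suc z) e₁) (lem₁ (F n) s)) ,
        trans (cong₂ (λ a c → suc (a + c * a)) e₂ e) (lem₂ t p u f)
      where
      lem₁ : ∀ x s → x * s + x * suc (x * s) ≡ x * suc (s + x * s)
      lem₁ = solve-∀
      lem₂ : ∀ t p u f → suc (t + p * u + p * f * (t + p * u)) ≡ suc t + p * (u + f * (t + p * u))
      lem₂ = solve-∀

    -- Lifting the exponent, for a prime not dividing the exponent.
    F-part : ∀ {p v} n t → Prime p → p ∣ F n → ¬ (p ∣ t) → Part p (F n) v → Part p (F (t * n)) v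
    F-part {p} {v} n t pp d p∤t h with F-quotient n t (quotient d) p (m∣n⇒n≡m*quotient d)
    ... | s , u , e , refl = subst₂ (Part p) (sym e) (+-identityʳ v)
      (part-* pp h (part-0 λ d′ → p∤t (∣m+n∣m⇒∣n (subst (p ∣_) (+-comm t (p * u)) d′) (m∣m*n u))))

    -- (num S c) / (den S c) is the product of (b ^ (n / d) - 1) ^ μ(d) over the
    -- divisors d of the product of S, where n = c * product S.
    num den : List ℕ → ℕ → ℕ
    num [] c = F c
    num (ℓ ∷ S) c = num S (c * ℓ) * den S c
    den [] c = 1
    den (ℓ ∷ S) c = den S (c * ℓ) * num S c

    -- n is the order of b modulo p, as far as the primes in S can tell.
    NewAt : ℕ → List ℕ → ℕ → Set
    NewAt p S n = p ∣ F n × (∀ ℓ → ℓ ∈ S → ∀ d → d * ℓ ≡ n → ¬ (p ∣ F d))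

    module _ {p} (pp : Prime p) (M : ℕ) (M≢0 : NonZero M) {v} (H : ∀ n → n ∣ M → p ∣ F n → Part p (F n) v) where

      -- By `H` every factor has valuation `v` or 0, so numerator and denominator differ by `v`
      -- times a signed count of the exponents `n` with `p ∣ F n`. Adding a prime `ℓ` subtracts the
      -- count at `n₀ = n / ℓ` from that at `n`; the induction shows that the count is 1 at a new
      -- exponent and 0 elsewhere.
      num-den-part : ∀ S c → All Prime S → Unique S → c * product S ∣ M →
        (NewAt p S (c * product S) × ∃ λ u → Part p (num S c) (u + v) × Part p (den S c) u)
        ⊎ (¬ NewAt p S (c * product S) × ∃ λ u → Part p (num S c) u × Part p (den S c) u)
      num-den-part [] c [] [] d rewrite *-identityʳ c with p ∣? F c
      ... | yes p∣F = inj₁ ((p∣F , λ _ ()) , 0 , H c d p∣F , part-0 (λ d → prime≢1 pp (∣1⇒≡1 d)))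
      ... | no ¬p∣F = inj₂ ((λ h → ¬p∣F (proj₁ h)) , 0 , part-0 ¬p∣F , part-0 (λ d → prime≢1 pp (∣1⇒≡1 d)))
      num-den-part (ℓ ∷ S) c (pℓ ∷ pS) (ℓ∉S ∷ uS) d
        with num-den-part S (c * ℓ) pS uS (subst (_∣ M) (sym (*-assoc c ℓ (product S))) d)
           | num-den-part S c pS uS (∣-trans (*-monoʳ-∣ c (n∣m*n ℓ)) d)
      ... | q₁ | q₀ rewrite *-assoc c ℓ (product S) = combine q₁ q₀
        where
        n₀ n : ℕ
        n₀ = c * product S
        n = c * (ℓ * product S)
        n≡ : n₀ * ℓ ≡ n
        n≡ = (λ (a b c : ℕ) → lem a b c) c (product S) ℓ
          where
          lem : ∀ a b c → a * b * c ≡ a * (c * b)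
          lem = solve-∀
        up : p ∣ F n₀ → p ∣ F n
        up h = subst (λ z → p ∣ F z) (trans (*-comm ℓ n₀) n≡) (F-∣ n₀ ℓ h)
        -- If `d * ℓ′ = n` with `ℓ′` different from `ℓ`, then `ℓ` divides `d` and the gcd of `n₀`
        -- and `d` is `n₀ / ℓ′`. So `p ∣ F d` would descend to `p ∣ F (n₀ / ℓ′)`.
        full₀⇒full : NewAt p S n₀ → NewAt p S n
        full₀⇒full (h , g) = up h , λ ℓ′ ℓ′∈S d dℓ′≡n p∣Fd →
          let ℓ∣d : ℓ ∣ d
              ℓ∣d = [ (λ x → x) , (λ ℓ∣ℓ′ → ⊥-elim (All¬⇒¬Any ℓ∉S (subst (_∈ S) (sym (prime-∣⇒≡ pℓ (lookupA pS ℓ′∈S) ℓ∣ℓ′)) ℓ′∈S))) ]′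
                      (euclidsLemma d ℓ′ pℓ (subst (ℓ ∣_) (trans n≡ (sym dℓ′≡n)) (n∣m*n n₀)))
              d′ = quotient ℓ∣d
              d≡ : d ≡ d′ * ℓ
              d≡ = m∣n⇒n≡quotient*m ℓ∣d
              instance _ = prime⇒nonZero pℓ
              n₀≡ : d′ * ℓ′ ≡ n₀
              n₀≡ = *-cancelʳ-≡ _ _ ℓ (trans (trans (swap d′ ℓ′ ℓ) (cong (_* ℓ′) (sym d≡))) (trans dℓ′≡n (sym n≡)))
              g≡ : gcd n₀ d ≡ d′
              g≡ = trans (cong₂ gcd (sym n₀≡) d≡) (trans (sym (c*gcd[m,n]≡gcd[cm,cn] d′ ℓ′ ℓ))
                     (trans (cong (d′ *_) (coprime-primes (lookupA pS ℓ′∈S) pℓ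
                       (λ e → All¬⇒¬Any ℓ∉S (subst (_∈ S) e ℓ′∈S)))) (*-identityʳ d′)))
          in g ℓ′ ℓ′∈S d′ n₀≡ (subst (λ z → p ∣ F z) g≡ (F-gcd n₀ d h p∣Fd))
          where
          open import Data.Sum using ([_,_]′)
          open import Data.List.Relation.Unary.All using () renaming (lookup to lookupA)
          swap : ∀ a b c → a * b * c ≡ a * c * b
          swap = solve-∀
          coprime-primes : ∀ {q r} → Prime q → Prime r → q ≢ r → gcd q r ≡ 1
          coprime-primes {q} {r} pq pr q≢r with prime⇒irreducible pq (gcd[m,n]∣m q r)
          ... | inj₁ e = e
          ... | inj₂ e = ⊥-elim (q≢r (prime-∣⇒≡ pq pr (subst (_∣ r) e (gcd[m,n]∣n q r))))
        full⇒full₀ : NewAt p S n → p ∣ F n₀ → NewAt p S n₀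
        full⇒full₀ (_ , g) h = h , λ ℓ′ ℓ′∈S d e p∣Fd → g ℓ′ ℓ′∈S (ℓ * d)
          (trans (*-assoc ℓ d ℓ′) (trans (cong (ℓ *_) e) (trans (*-comm ℓ n₀) n≡))) (F-∣ d ℓ p∣Fd)
        weaken : NewAt p (ℓ ∷ S) n → NewAt p S n
        weaken (h , g) = h , λ ℓ′ ℓ′∈S → g ℓ′ (there ℓ′∈S)
        shift₁ : ∀ a b v → a + v + b ≡ a + b + v
        shift₁ = solve-∀
        shift₂ : ∀ a b v → a + (b + v) ≡ a + b + v
        shift₂ = solve-∀
        combine : _ → _ → _
        -- If both are new, the two contributions `v` fall on opposite sides and cancel. If only `n`
        -- is new, one survives. That only `n₀` is new is excluded by `full₀⇒full`.
        combine (inj₁ (f , u , a , b)) (inj₁ (f₀ , u₀ , a₀ , b₀)) =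
          inj₂ ((λ h → proj₂ h ℓ (here refl) n₀ n≡ (proj₁ f₀)) , u + u₀ + v ,
            subst (Part p _) (shift₁ u u₀ v) (part-* pp a b₀) , subst (Part p _) (shift₂ u u₀ v) (part-* pp b a₀))
        combine (inj₁ (f , u , a , b)) (inj₂ (¬f₀ , u₀ , a₀ , b₀)) =
          inj₁ ((proj₁ f , λ { ℓ′ (there q) → proj₂ f ℓ′ q
                             ; ℓ′ (here refl) d e p∣Fd → ¬f₀ (full⇒full₀ f (subst (λ z → p ∣ F z) {d} {n₀}
                                 (*-cancelʳ-≡ d n₀ ℓ {{prime⇒nonZero pℓ}} (trans e (sym n≡))) p∣Fd)) }) ,
            u + u₀ , subst (Part p _) (shift₁ u u₀ v) (part-* pp a b₀) , part-* pp b a₀)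
        combine (inj₂ (¬f , u , a , b)) (inj₁ (f₀ , _)) = ⊥-elim (¬f (full₀⇒full f₀))
        combine (inj₂ (¬f , u , a , b)) (inj₂ (¬f₀ , u₀ , a₀ , b₀)) =
          inj₂ ((λ h → ¬f (weaken h)) , u + u₀ , part-* pp a b₀ , part-* pp b a₀)

    private
      infix 4 _≈_mod_
      _≈_mod_ : ℕ → ℕ → (q : ℕ) → .{{NonZero q}} → Set
      x ≈ y mod q = x % q ≡ y % q

      *-mod : ∀ {x x′ y y′} q → .{{_ : NonZero q}} → x ≈ x′ mod q → y ≈ y′ mod q → x * y ≈ x′ * y′ mod q
      *-mod {x} {x′} {y} {y′} q e f = trans (%-distribˡ-* x y q)
        (trans (cong₂ (λ a c → (a * c) % q) e f) (sym (%-distribˡ-* x′ y′ q)))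

      sq : ℕ → ℕ
      sq x = x * x

      sq-* : ∀ x y → x * y * (x * y) ≡ x * x * (y * y)
      sq-* = solve-∀

      b^≢0 : ∀ r → NonZero (b ^ r)
      b^≢0 r = m^n≢0 b r

      sq-F : ∀ c → sq (F c) + 2 * b ^ c ≡ 1 + b ^ c * b ^ c
      sq-F c = subst (λ z → sq (F c) + 2 * z ≡ 1 + z * z) (suc-F c) (lem (F c))
        where
        lem : ∀ x → x * x + 2 * suc x ≡ 1 + suc x * suc x
        lem = solve-∀

    private
      mul-pair : ∀ q → .{{_ : NonZero q}} → ∀ {u v x y} m n →
        sq m ≈ u mod q → sq n ≈ v mod q → u * v ≡ y → y ≡ x → sq (m * n) ≈ x mod q
      mul-pair q m n e f refl refl = trans (cong (_% q) (sq-* m n)) (*-mod q e f)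

    -- num and den are told apart modulo b ^ (c + 1), where every F n with n > c is
    -- congruent to -1; squaring removes the signs.
    num²≈1 : ∀ S c r → All Prime S → r ≤ c →
      (_≈_mod_ (sq (num S c)) 1 (b ^ r) {{b^≢0 r}}) × (_≈_mod_ (sq (den S c)) 1 (b ^ r) {{b^≢0 r}})
    num²≈1 [] c r _ r≤c = eq , refl
      where
      instance _ = b^≢0 r
      open ≡-Reasoning
      k = b ^ (c ∸ r)
      b^c : b ^ c ≡ k * b ^ r
      b^c = trans (cong (b ^_) (sym (m∸n+n≡m r≤c))) (^-distribˡ-+-* b (c ∸ r) r)
      eq : sq (F c) ≈ 1 mod b ^ r
      eq = begin
        sq (F c) % b ^ r                       ≡⟨ [m+kn]%n≡m%n (sq (F c)) (2 * k) (b ^ r) ⟨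
        (sq (F c) + 2 * k * b ^ r) % b ^ r     ≡⟨ cong (λ z → (sq (F c) + z) % b ^ r) (trans (*-assoc 2 k (b ^ r)) (cong (2 *_) (sym b^c))) ⟩
        (sq (F c) + 2 * b ^ c) % b ^ r         ≡⟨ cong (_% b ^ r) (sq-F c) ⟩
        (1 + b ^ c * b ^ c) % b ^ r            ≡⟨ cong (λ z → (1 + z) % b ^ r) (trans (cong (b ^ c *_) b^c) (sym (*-assoc (b ^ c) k (b ^ r)))) ⟩
        (1 + b ^ c * k * b ^ r) % b ^ r        ≡⟨ [m+kn]%n≡m%n 1 (b ^ c * k) (b ^ r) ⟩
        1 % b ^ r                              ∎
    num²≈1 (ℓ ∷ S) c r (pℓ ∷ pS) r≤c
      with num²≈1 S (c * ℓ) r pS (≤-trans r≤c (m≤m*n c ℓ {{prime⇒nonZero pℓ}})) | num²≈1 S c r pS r≤c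
    ... | n₁ , d₁ | n₀ , d₀ = mul-pair (b ^ r) (num S (c * ℓ)) (den S c) n₁ d₀ refl refl
                            , mul-pair (b ^ r) (den S (c * ℓ)) (num S c) d₁ n₀ refl refl
      where instance _ = b^≢0 r

    -- The exponent `c` belongs to the empty subset of `S` only up to the choice of side: `F c`
    -- occurs once, in the numerator or in the denominator by the parity of the length of `S`. All
    -- other exponents exceed `c`, and their factors square to 1.
    num²den² : ∀ S c → .{{NonZero c}} → All Prime S →
      let instance _ = b^≢0 (suc c) in
        (sq (num S c) ≈ sq (F c) mod b ^ suc c × sq (den S c) ≈ 1 mod b ^ suc c)
      ⊎ (sq (num S c) ≈ 1 mod b ^ suc c × sq (den S c) ≈ sq (F c) mod b ^ suc c)
    num²den² [] c [] = inj₁ (refl , refl)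
    num²den² (ℓ ∷ S) c (pℓ ∷ pS)
      with num²≈1 S (c * ℓ) (suc c) pS (m<m*n c ℓ {{it}} (nonTrivial⇒n>1 ℓ {{prime⇒nonTrivial pℓ}})) | num²den² S c pS
      where it = >-nonZero (>-nonZero⁻¹ c)
    ... | n₁ , d₁ | inj₁ (n₀ , d₀) = inj₂
      ( mul-pair (b ^ suc c) {{b^≢0 (suc c)}} (num S (c * ℓ)) (den S c) n₁ d₀ refl refl
      , mul-pair (b ^ suc c) {{b^≢0 (suc c)}} (den S (c * ℓ)) (num S c) d₁ n₀ refl (+-identityʳ _))
    ... | n₁ , d₁ | inj₂ (n₀ , d₀) = inj₁
      ( mul-pair (b ^ suc c) {{b^≢0 (suc c)}} (num S (c * ℓ)) (den S c) n₁ d₀ refl (+-identityʳ _)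
      , mul-pair (b ^ suc c) {{b^≢0 (suc c)}} (den S (c * ℓ)) (num S c) d₁ n₀ refl refl)

    -- Modulo `b ^ (c + 1)` the square of `b ^ c - 1` is `1 - 2 * b ^ c`, because `c ≥ 1` makes
    -- `b ^ (2 * c)` vanish. As `b ≥ 3`, the term `2 * b ^ c` is nonzero and below the modulus.
    F²≉1 : ∀ c → .{{NonZero c}} → ¬ (_≈_mod_ (sq (F c)) 1 (b ^ suc c) {{b^≢0 (suc c)}})
    F²≉1 c@(suc c′) h = contra
      where
      open import Data.Nat.DivMod using (m<n⇒m%n≡m)
      q = b ^ suc c
      X = b ^ c
      instance _ = b^≢0 (suc c)
      1≤X : 1 ≤ X
      1≤X = >-nonZero⁻¹ X {{b^≢0 c}}
      big : 1 + 2 * X < q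
      big = begin-strict
        1 + 2 * X    <⟨ +-monoˡ-< (2 * X) (≤-trans (≤-trans (s≤s (s≤s z≤n)) 3≤b) (m≤m*n b (b ^ c′) {{b^≢0 c′}})) ⟩
        X + 2 * X    ≤⟨ *-monoˡ-≤ X 3≤b ⟩
        b * X        ∎
        where open ≤-Reasoning
      Xb = b ^ c′
      sqX : X * X ≡ Xb * q
      sqX = lem b Xb
        where
        lem : ∀ b x → b * x * (b * x) ≡ x * (b * (b * x))
        lem = solve-∀
      chain : (1 + 2 * X) % q ≡ 1 % q
      chain = begin
        (1 + 2 * X) % q                      ≡⟨ %-distribˡ-+ 1 (2 * X) q ⟩
        (1 % q + (2 * X) % q) % q            ≡⟨ cong (λ z → (z + (2 * X) % q) % q) h ⟨
        (sq (F c) % q + (2 * X) % q) % q     ≡⟨ %-distribˡ-+ (sq (F c)) (2 * X) q ⟨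
        (sq (F c) + 2 * X) % q               ≡⟨ cong (_% q) (trans (sq-F c) (cong suc sqX)) ⟩
        (1 + Xb * q) % q                     ≡⟨ [m+kn]%n≡m%n 1 Xb q ⟩
        1 % q                                ∎
        where open ≡-Reasoning
      contra : ⊥
      contra = m+1+n≢m 1 (trans (cong suc (suc-pred (2 * X) {{m*n≢0 2 X {{_}} {{b^≢0 c}}}}))
        (trans (sym (m<n⇒m%n≡m big)) (trans chain (m<n⇒m%n≡m (<-trans (s≤s (≤-trans 1≤X (m≤n*m X 2))) big)))))

    num≢den : ∀ S c → .{{NonZero c}} → All Prime S → num S c ≢ den S c
    num≢den S c pS e with num²den² S c pS
    ... | inj₁ (n , d) = F²≉1 c (trans (sym n) (trans (cong (λ z → _%_ (sq z) (b ^ suc c) {{b^≢0 (suc c)}}) e) d))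
    ... | inj₂ (n , d) = F²≉1 c (trans (sym d) (trans (cong (λ z → _%_ (sq z) (b ^ suc c) {{b^≢0 (suc c)}}) (sym e)) n))

    num≢0 : ∀ S c → .{{NonZero c}} → All Prime S → NonZero (num S c) × NonZero (den S c)
    num≢0 [] c [] = >-nonZero (<-trans z<s (1<F c)) , _
    num≢0 (ℓ ∷ S) c (pℓ ∷ pS) with num≢0 S (c * ℓ) {{m*n≢0 c ℓ {{it}} {{prime⇒nonZero pℓ}}}} pS | num≢0 S c pS
      where it = >-nonZero (>-nonZero⁻¹ c)
    ... | n₁ , d₁ | n₀ , d₀ = m*n≢0 _ _ {{n₁}} {{d₀}} , m*n≢0 _ _ {{d₁}} {{n₀}}

    -- A prime at which numerator and denominator differ must divide `F M`; otherwise no factor is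
    -- divisible by it, and `num-den-part` applies with `v = 0`. It does not divide `b`, hence not
    -- `M`, since all primes of `M` divide `b`. So lifting the exponent gives all divisible factors
    -- the same valuation, and newness follows.
    primitive-prime : ∀ M → .{{NonZero M}} → (∀ {p} → Prime p → p ∣ M → p ∣ b) →
      ∃ λ p → Prime p × ¬ (p ∣ b) × ∀ N → p ∣ F N → M ∣ N
    primitive-prime M@(suc _) M⇒b with squarefree-kernel M
    ... | c , S , eM , pS , uS , primes∈S with ≢⇒∃-different-part (num S c) (den S c) {{proj₁ nz}} {{proj₂ nz}} (num≢den S c {{c≢0}} pS)
      where
      c≢0 : NonZero c
      c≢0 = ≢-nonZero λ c≡0 → 0≢1+n (trans (sym (cong (_* product S) c≡0)) eM)
      nz = num≢0 S c {{c≢0}} pS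
    ... | p , pp , diff with p ∣? F M
    ...   | no p∤F = ⊥-elim (absurd (num-den-part pp M _ {0} (λ n n∣M d → ⊥-elim (p∤F
              (subst (λ z → p ∣ F z) (sym (m∣n⇒n≡quotient*m n∣M)) (F-∣ n (quotient n∣M) d)))) S c pS uS (subst (_∣ M) (sym eM) ∣-refl)))
      where
      absurd : _ → ⊥
      absurd (inj₁ ((h , _) , _)) = p∤F (subst (λ z → p ∣ F z) eM h)
      absurd (inj₂ (_ , u , x , y)) = diff u x y
    ...   | yes p∣F with ∃-part pp (F M) {{>-nonZero (<-trans z<s (1<F M))}}
    ...     | v , hv = p , pp , p∤b , order
      where
      p∤b : ¬ (p ∣ b)
      p∤b = F∣⇒∤b M pp p∣F
      H : ∀ n → n ∣ M → p ∣ F n → Part p (F n) v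
      H n n∣M d with ∃-part pp (F n) {{>-nonZero (<-trans z<s (1<F n {{n≢0}}))}}
        where
        n≢0 : NonZero n
        n≢0 = ≢-nonZero λ { refl → 0≢1+n (sym (0∣⇒≡0 n∣M)) }
      ... | u , hu = subst (Part p (F n)) (part-unique pp
              (F-part n (quotient n∣M) pp d (λ h → p∤b (M⇒b pp (∣-trans h (quotient-∣ n∣M)))) hu)
              (subst (λ z → Part p (F z) v) (m∣n⇒n≡quotient*m n∣M) hv)) hu
      new : NewAt p S (c * product S)
      new with num-den-part pp M _ H S c pS uS (subst (_∣ M) (sym eM) ∣-refl)
      ... | inj₁ (h , _) = h
      ... | inj₂ (_ , u , x , y) = ⊥-elim (diff u x y)
      -- If the gcd of `M` and `N` were a proper divisor of `M`, it would divide `M / ℓ` for some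
      -- prime `ℓ`, and `p ∣ F (M / ℓ)` contradicts newness.
      order : ∀ N → p ∣ F N → M ∣ N
      order N d with 1 <? quotient (gcd[m,n]∣m M N)
      ... | no ¬1< = subst (_∣ N) (sym M≡g) (gcd[m,n]∣n M N)
        where
        g∣ = gcd[m,n]∣m M N
        M≡g : M ≡ gcd M N
        M≡g = trans (m∣n⇒n≡quotient*m g∣) (trans (cong (_* gcd M N)
          (≤-antisym (≮⇒≥ ¬1<) (>-nonZero⁻¹ _ {{quotient≢0 g∣}}))) (*-identityˡ (gcd M N)))
      ... | yes 1< with ∃-prime-divisor _ 1<
      ...   | ℓ , pℓ , ℓ∣t = ⊥-elim (proj₂ new ℓ (primes∈S ℓ pℓ (∣-trans ℓ∣t (quotient-∣ (gcd[m,n]∣m M N))))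
                (quotient ℓ∣t * gcd M N) eq (F-∣ (gcd M N) (quotient ℓ∣t) (F-gcd M N p∣F d)))
        where
        swap : ∀ a b c → a * b * c ≡ a * c * b
        swap = solve-∀
        eq : quotient ℓ∣t * gcd M N * ℓ ≡ c * product S
        eq = trans (swap (quotient ℓ∣t) (gcd M N) ℓ) (trans (cong (_* gcd M N) (sym (m∣n⇒n≡quotient*m ℓ∣t)))
               (trans (sym (m∣n⇒n≡quotient*m (gcd[m,n]∣m M N))) (sym eM)))

  ∃-large-prime-with-order : ∀ M → .{{NonZero M}} → ∀ B →
    ∃ λ p → Prime p × B < p × ∃ λ b → ¬ (p ∣ b) × ∀ N → p ∣ pred (b ^ N) → M ∣ N
  ∃-large-prime-with-order M B with PowersMinusOne.primitive-prime b 3≤b M (λ pp d → ∣n⇒∣m*n 3 (∣m⇒∣m*n (B !) d))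
    where
    -- The factor 3 ensures `b ≥ 3`, the factor `M` puts its primes into `b`, and `B !` contains
    -- every prime up to `B`, so a prime not dividing `b` exceeds `B`.
    b = 3 * (M * B !)
    3≤b : 3 ≤ b
    3≤b = m≤m*n 3 (M * B !) {{m*n≢0 M (B !) {{it}} {{B !≢0}}}}
      where it = >-nonZero (>-nonZero⁻¹ M)
  ... | p , pp , p∤b , ord = p , pp , ≰⇒> (λ p≤B → p∤b (∣n⇒∣m*n 3 (∣n⇒∣m*n M (p∣B! p≤B)))) , 3 * (M * B !) , p∤b , ord
    where
    p∣B! : ∀ {n} → p ≤ n → p ∣ n !
    p∣B! {zero} z≤n = ⊥-elim (¬prime[0] pp)
    p∣B! {suc n} p≤ with m≤n⇒m<n∨m≡n p≤
    ... | inj₁ p< = ∣n⇒∣m*n (suc n) (p∣B! (≤-pred p<))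
    ... | inj₂ refl = m∣m*n (n !)

-- Finite fields, and the integers modulo a prime.

module FiniteFields where

  open import Data.Nat as ℕ using (ℕ; zero; suc; NonZero)
  import Data.Nat.Properties as ℕ
  open import Data.Nat.DivMod using (_%_; _mod_; m%n<n; %-distribˡ-+; %-distribˡ-*; m<n⇒m%n≡m; [m+kn]%n≡m%n; m*n%n≡0; n%n≡0)
  open import Data.Nat.Divisibility using (_∣_; ∣⇒≤)
  open import Data.Nat.Primality using (Prime; prime⇒nonZero; prime⇒nonTrivial; prime⇒irreducible)
  open import Data.Nat.GCD using (gcd; gcd[m,n]∣m; gcd[m,n]∣n; gcd-GCD; module Bézout)
  open import Data.Fin as Fin using (Fin; zero; suc; toℕ)
  import Data.Fin.Properties as Fin
  open import Data.Product using (∃; _,_)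
  open import Data.Sum using (inj₁; inj₂)
  open import Data.Empty using (⊥-elim)
  open import Relation.Binary.PropositionalEquality hiding ([_])
  open import Algebra.Bundles using (CommutativeRing)
  open import Level using (0ℓ)
  import Algebra.Structures as Structures

  record Field (q : ℕ) : Set where
    infixl 6 _+_
    infixl 7 _*_
    infix 8 -_
    field
      _+_ _*_ : Fin q → Fin q → Fin q
      -_ : Fin q → Fin q
      0# 1# : Fin q
      isCommutativeRing : Structures.IsCommutativeRing {A = Fin q} _≡_ _+_ _*_ -_ 0# 1#
      1≢0 : 1# ≢ 0#
      ∃-inverse : ∀ x → x ≢ 0# → ∃ λ y → y * x ≡ 1#

    commutativeRing : CommutativeRing 0ℓ 0ℓ
    commutativeRing = record { isCommutativeRing = isCommutativeRing }

  module IntegersMod (p : ℕ) (pp : Prime p) where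

    instance
      p≢0 : NonZero p
      p≢0 = prime⇒nonZero pp

    [_] : ℕ → Fin p
    [ n ] = n mod p

    toℕ-[] : ∀ n → toℕ [ n ] ≡ n % p
    toℕ-[] n = Fin.toℕ-fromℕ< (m%n<n n p)

    []-toℕ : ∀ x → [ toℕ x ] ≡ x
    []-toℕ x = Fin.toℕ-injective (trans (toℕ-[] (toℕ x)) (m<n⇒m%n≡m (Fin.toℕ<n x)))

    []-cong : ∀ {m n} → m % p ≡ n % p → [ m ] ≡ [ n ]
    []-cong {m} {n} e = Fin.toℕ-injective (trans (toℕ-[] m) (trans e (sym (toℕ-[] n))))

    []-injective : ∀ {m n} → [ m ] ≡ [ n ] → m % p ≡ n % p
    []-injective {m} {n} e = trans (sym (toℕ-[] m)) (trans (cong toℕ e) (toℕ-[] n))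

    infixl 6 _⊕_
    infixl 7 _⊗_
    _⊕_ _⊗_ : Fin p → Fin p → Fin p
    x ⊕ y = [ toℕ x ℕ.+ toℕ y ]
    x ⊗ y = [ toℕ x ℕ.* toℕ y ]

    ⊖_ : Fin p → Fin p
    ⊖ x = [ p ℕ.∸ toℕ x ]

    []-+ : ∀ m n → [ m ] ⊕ [ n ] ≡ [ m ℕ.+ n ]
    []-+ m n = []-cong (trans (cong₂ (λ a b → (a ℕ.+ b) % p) (toℕ-[] m) (toℕ-[] n)) (sym (%-distribˡ-+ m n p)))

    []-* : ∀ m n → [ m ] ⊗ [ n ] ≡ [ m ℕ.* n ]
    []-* m n = []-cong (trans (cong₂ (λ a b → (a ℕ.* b) % p) (toℕ-[] m) (toℕ-[] n)) (sym (%-distribˡ-* m n p)))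

    private
      -- As `[_]` is onto, a ring law need only be checked on residues of natural numbers, where
      -- `[]-+` and `[]-*` reduce it to the law in ℕ.
      lift₁ : ∀ {f g : Fin p → Fin p} → (∀ m → f [ m ] ≡ g [ m ]) → ∀ x → f x ≡ g x
      lift₁ {f} {g} h x = subst (λ x → f x ≡ g x) ([]-toℕ x) (h (toℕ x))

      lift₂ : ∀ {f g : Fin p → Fin p → Fin p} → (∀ m n → f [ m ] [ n ] ≡ g [ m ] [ n ]) → ∀ x y → f x y ≡ g x y
      lift₂ h x = lift₁ (λ n → lift₁ (λ m → h m n) x)

      lift₃ : ∀ {f g : Fin p → Fin p → Fin p → Fin p} →
        (∀ l m n → f [ l ] [ m ] [ n ] ≡ g [ l ] [ m ] [ n ]) → ∀ x y z → f x y z ≡ g x y z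
      lift₃ h x y = lift₁ (λ n → lift₂ (λ l m → h l m n) x y)

    ⊕-assoc : ∀ x y z → (x ⊕ y) ⊕ z ≡ x ⊕ (y ⊕ z)
    ⊕-assoc = lift₃ λ l m n → trans (trans (cong (_⊕ [ n ]) ([]-+ l m)) ([]-+ (l ℕ.+ m) n))
      (trans (cong [_] (ℕ.+-assoc l m n)) (sym (trans (cong ([ l ] ⊕_) ([]-+ m n)) ([]-+ l (m ℕ.+ n)))))

    ⊗-assoc : ∀ x y z → (x ⊗ y) ⊗ z ≡ x ⊗ (y ⊗ z)
    ⊗-assoc = lift₃ λ l m n → trans (trans (cong (_⊗ [ n ]) ([]-* l m)) ([]-* (l ℕ.* m) n))
      (trans (cong [_] (ℕ.*-assoc l m n)) (sym (trans (cong ([ l ] ⊗_) ([]-* m n)) ([]-* l (m ℕ.* n)))))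

    ⊕-comm : ∀ x y → x ⊕ y ≡ y ⊕ x
    ⊕-comm x y = cong [_] (ℕ.+-comm (toℕ x) (toℕ y))

    ⊗-comm : ∀ x y → x ⊗ y ≡ y ⊗ x
    ⊗-comm x y = cong [_] (ℕ.*-comm (toℕ x) (toℕ y))

    ⊕-identityˡ : ∀ x → [ 0 ] ⊕ x ≡ x
    ⊕-identityˡ = lift₁ ([]-+ 0)

    ⊗-identityˡ : ∀ x → [ 1 ] ⊗ x ≡ x
    ⊗-identityˡ = lift₁ λ m → trans ([]-* 1 m) (cong [_] (ℕ.*-identityˡ m))

    ⊕-inverseˡ : ∀ x → ⊖ x ⊕ x ≡ [ 0 ]
    ⊕-inverseˡ x = trans (cong (⊖ x ⊕_) (sym ([]-toℕ x))) (trans ([]-+ (p ℕ.∸ toℕ x) (toℕ x))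
      ([]-cong (trans (cong (_% p) (ℕ.m∸n+n≡m (ℕ.<⇒≤ (Fin.toℕ<n x)))) (trans (n%n≡0 p) (sym (m*n%n≡0 0 p))))))

    ⊗-distribˡ-⊕ : ∀ x y z → x ⊗ (y ⊕ z) ≡ x ⊗ y ⊕ x ⊗ z
    ⊗-distribˡ-⊕ = lift₃ λ l m n → trans (trans (cong ([ l ] ⊗_) ([]-+ m n)) ([]-* l (m ℕ.+ n)))
      (trans (cong [_] (ℕ.*-distribˡ-+ l m n)) (sym (trans (cong₂ _⊕_ ([]-* l m) ([]-* l n)) ([]-+ (l ℕ.* m) (l ℕ.* n)))))

    [1]≢[0] : [ 1 ] ≢ [ 0 ]
    [1]≢[0] e with () ← trans (sym (m<n⇒m%n≡m (ℕ.nonTrivial⇒n>1 p {{prime⇒nonTrivial pp}})))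
                          (trans ([]-injective e) (m*n%n≡0 0 p))

    ⊗-inverse : ∀ x → x ≢ [ 0 ] → ∃ λ y → y ⊗ x ≡ [ 1 ]
    ⊗-inverse x x≢0 = from-Bézout (subst (λ d → Bézout.Identity d (toℕ x) p) gcd≡1 (Bézout.identity (gcd-GCD (toℕ x) p)))
      where
      tx≢0 : toℕ x ≢ 0
      tx≢0 e = x≢0 (trans (sym ([]-toℕ x)) (cong [_] e))
      gcd≡1 : gcd (toℕ x) p ≡ 1
      gcd≡1 with prime⇒irreducible pp (gcd[m,n]∣n (toℕ x) p)
      ... | inj₁ e = e
      ... | inj₂ e = ⊥-elim (ℕ.<⇒≱ (Fin.toℕ<n x) (∣⇒≤ {{ℕ.≢-nonZero tx≢0}} (subst (_∣ toℕ x) e (gcd[m,n]∣m (toℕ x) p))))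
      *x : ∀ a → [ a ] ⊗ x ≡ [ a ℕ.* toℕ x ]
      *x a = trans (cong ([ a ] ⊗_) (sym ([]-toℕ x))) ([]-* a (toℕ x))
      from-Bézout : Bézout.Identity 1 (toℕ x) p → ∃ λ y → y ⊗ x ≡ [ 1 ]
      from-Bézout (Bézout.+- a b eq) = [ a ] , trans (*x a) ([]-cong (trans (cong (_% p) (sym eq)) ([m+kn]%n≡m%n 1 b p)))
      -- Here `1 + a * toℕ x = b * p`, so `a` is minus an inverse of `x`; the factor `p′ = p - 1`
      -- corrects the sign.
      from-Bézout (Bézout.-+ a b eq) = [ p′ ℕ.* a ] , trans (*x (p′ ℕ.* a)) ([]-cong (begin
        p′ ℕ.* a ℕ.* t % p                      ≡⟨ [m+kn]%n≡m%n (p′ ℕ.* a ℕ.* t) 1 p ⟨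
        (p′ ℕ.* a ℕ.* t ℕ.+ 1 ℕ.* p) % p        ≡⟨ cong (_% p) rearranged ⟩
        (1 ℕ.+ p′ ℕ.* b ℕ.* p) % p              ≡⟨ [m+kn]%n≡m%n 1 (p′ ℕ.* b) p ⟩
        1 % p                                   ∎))
        where
        open ≡-Reasoning
        open import Data.Nat.Tactic.RingSolver using (solve-∀)
        p′ = ℕ.pred p
        t = toℕ x
        rearranged : p′ ℕ.* a ℕ.* t ℕ.+ 1 ℕ.* p ≡ 1 ℕ.+ p′ ℕ.* b ℕ.* p
        rearranged = trans (cong (λ z → p′ ℕ.* a ℕ.* t ℕ.+ 1 ℕ.* z) (sym (ℕ.suc-pred p)))
          (trans (lem p′ a t) (trans (cong (λ z → 1 ℕ.+ p′ ℕ.* z) eq) (cong suc (sym (ℕ.*-assoc p′ b p)))))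
          where
          lem : ∀ p a t → p ℕ.* a ℕ.* t ℕ.+ 1 ℕ.* suc p ≡ 1 ℕ.+ p ℕ.* (1 ℕ.+ a ℕ.* t)
          lem = solve-∀

    integersMod : Field p
    integersMod = record
      { _+_ = _⊕_ ; _*_ = _⊗_ ; -_ = ⊖_ ; 0# = [ 0 ] ; 1# = [ 1 ]
      ; isCommutativeRing = record
        { isRing = record
          { +-isAbelianGroup = record
            { isGroup = record
              { isMonoid = record
                { isSemigroup = record
                  { isMagma = record { isEquivalence = isEquivalence ; ∙-cong = cong₂ _⊕_ }
                  ; assoc = ⊕-assoc }
                ; identity = ⊕-identityˡ , λ x → trans (⊕-comm x [ 0 ]) (⊕-identityˡ x) }
              ; inverse = ⊕-inverseˡ , λ x → trans (⊕-comm x (⊖ x)) (⊕-inverseˡ x)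
              ; ⁻¹-cong = cong ⊖_ }
            ; comm = ⊕-comm }
          ; *-cong = cong₂ _⊗_
          ; *-assoc = ⊗-assoc
          ; *-identity = ⊗-identityˡ , λ x → trans (⊗-comm x [ 1 ]) (⊗-identityˡ x)
          ; distrib = ⊗-distribˡ-⊕ , λ x y z → trans (⊗-comm (y ⊕ z) x) (trans (⊗-distribˡ-⊕ x y z) (cong₂ _⊕_ (⊗-comm x y) (⊗-comm x z))) }
        ; *-comm = ⊗-comm }
      ; 1≢0 = [1]≢[0]
      ; ∃-inverse = ⊗-inverse }

-- Counting by finite sums, and a second moment argument.

module Counting where

  open import Data.Nat
  open import Data.Nat.Properties
  open import Data.Nat.Tactic.RingSolver using (solve-∀)
  open import Data.Fin as Fin using (Fin; zero; suc)
  import Data.Fin.Properties as Fin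
  open import Data.Bool using (Bool; true; false; _∧_)
  import Data.Bool.Properties as Bool
  open import Data.Product using (∃; _×_; _,_)
  open import Data.Sum using (inj₁; inj₂)
  open import Data.Empty using (⊥-elim)
  open import Function using (_∘_)
  open import Relation.Nullary using (Dec; yes; no; does; ¬?)
  open import Relation.Nullary.Decidable using (_×-dec_; decidable-stable; dec-true)
  open import Relation.Binary.PropositionalEquality
  open import Algebra.Properties.Semiring.Sum +-*-semiring public
    using (sum; sum-cong-≗; ∑-distrib-+; ∑-comm; sum-permute; *-distribˡ-sum; *-distribʳ-sum)

  sum-mono : ∀ {n} {f g : Fin n → ℕ} → (∀ i → f i ≤ g i) → sum f ≤ sum g
  sum-mono {zero} h = z≤n
  sum-mono {suc n} h = +-mono-≤ (h zero) (sum-mono (h ∘ suc))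

  sum-const : ∀ n c → sum {n} (λ _ → c) ≡ n * c
  sum-const zero c = refl
  sum-const (suc n) c = cong (c +_) (sum-const n c)

  term≤sum : ∀ {n} (f : Fin n → ℕ) i → f i ≤ sum f
  term≤sum f zero = m≤m+n (f zero) _
  term≤sum f (suc i) = ≤-trans (term≤sum (f ∘ suc) i) (m≤n+m _ (f zero))

  -- This turns a double count whose upper and lower bounds meet into exact values of the single
  -- terms.
  sum-mono-equality : ∀ {n} {f g : Fin n → ℕ} → (∀ i → f i ≤ g i) → sum g ≤ sum f → ∀ i → f i ≡ g i
  sum-mono-equality {suc n} {f} {g} h le zero = ≤-antisym (h zero)
    (+-cancelʳ-≤ (sum (g ∘ suc)) (g zero) (f zero) (≤-trans le (+-monoʳ-≤ (f zero) (sum-mono (h ∘ suc)))))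
  sum-mono-equality {suc n} {f} {g} h le (suc i) = sum-mono-equality (h ∘ suc)
    (+-cancelˡ-≤ (g zero) _ _ (≤-trans le (+-monoˡ-≤ (sum (f ∘ suc)) (h zero)))) i

  ⟦_⟧ : Bool → ℕ
  ⟦ true ⟧ = 1
  ⟦ false ⟧ = 0

  ⟦⟧≤1 : ∀ b → ⟦ b ⟧ ≤ 1
  ⟦⟧≤1 true = ≤-refl
  ⟦⟧≤1 false = z≤n

  ⟦⟧-idem : ∀ b → ⟦ b ⟧ * ⟦ b ⟧ ≡ ⟦ b ⟧
  ⟦⟧-idem true = refl
  ⟦⟧-idem false = refl

  ⟦∧⟧ : ∀ a b → ⟦ a ∧ b ⟧ ≡ ⟦ a ⟧ * ⟦ b ⟧
  ⟦∧⟧ true b = sym (+-identityʳ ⟦ b ⟧)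
  ⟦∧⟧ false b = refl

  # : ∀ {n} → (Fin n → Bool) → ℕ
  # A = sum (λ x → ⟦ A x ⟧)

  #≤n : ∀ {n} (A : Fin n → Bool) → # A ≤ n
  #≤n {n} A = ≤-trans (sum-mono (λ x → ⟦⟧≤1 (A x))) (≤-reflexive (trans (sum-const n 1) (*-identityʳ n)))

  #≤1 : ∀ {n} (A : Fin n → Bool) → (∀ x y → A x ≡ true → A y ≡ true → x ≡ y) → # A ≤ 1
  #≤1 {zero} A h = z≤n
  #≤1 {suc n} A h with A zero in eq
  ... | false = #≤1 (A ∘ suc) (λ x y a b → Fin.suc-injective (h (suc x) (suc y) a b))
  ... | true = ≤-reflexive (cong suc (trans (sum-cong-≗ zeros) (trans (sum-const n 0) (*-zeroʳ n))))
    where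
    zeros : ∀ x → ⟦ A (suc x) ⟧ ≡ 0
    zeros x with A (suc x) in eq′
    ... | false = refl
    ... | true with () ← h zero (suc x) eq eq′

  #≥1 : ∀ {n} (A : Fin n → Bool) x → A x ≡ true → 1 ≤ # A
  #≥1 A x e = ≤-trans (≤-reflexive (cong ⟦_⟧ (sym e))) (term≤sum (λ y → ⟦ A y ⟧) x)

  -- The element x is replaced by the graph of f at x, which contributes one to
  -- the double sum; injectivity bounds the contribution of every value.
  #-injection : ∀ {m n} (A : Fin m → Bool) (B : Fin n → Bool) (f : Fin m → Fin n) →
    (∀ x → A x ≡ true → B (f x) ≡ true) → (∀ x y → A x ≡ true → A y ≡ true → f x ≡ f y → x ≡ y) → # A ≤ # B
  #-injection {m} {n} A B f maps inj = begin
    sum (λ x → ⟦ A x ⟧)                              ≤⟨ sum-mono row ⟩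
    sum (λ x → sum (λ y → ⟦ graph x y ⟧))            ≡⟨ ∑-comm (λ x y → ⟦ graph x y ⟧) ⟩
    sum (λ y → sum (λ x → ⟦ graph x y ⟧))            ≤⟨ sum-mono column ⟩
    sum (λ y → ⟦ B y ⟧)                              ∎
    where
    open ≤-Reasoning
    graph : Fin m → Fin n → Bool
    graph x y = A x ∧ does (f x Fin.≟ y)
    graph⇒A : ∀ x y → graph x y ≡ true → A x ≡ true
    graph⇒A x y e with A x
    ... | true = refl
    graph⇒≡ : ∀ x y → graph x y ≡ true → f x ≡ y
    graph⇒≡ x y e with A x | f x Fin.≟ y
    ... | true | yes p = p
    row : ∀ x → ⟦ A x ⟧ ≤ sum (λ y → ⟦ graph x y ⟧)
    row x with A x in eq
    ... | false = z≤n
    ... | true = #≥1 (λ y → does (f x Fin.≟ y)) (f x) (dec-true (f x Fin.≟ f x) refl)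
    column : ∀ y → sum (λ x → ⟦ graph x y ⟧) ≤ ⟦ B y ⟧
    column y with B y in eq
    ... | true = #≤1 (λ x → graph x y) (λ x x′ e e′ → inj x x′ (graph⇒A x y e) (graph⇒A x′ y e′)
                   (trans (graph⇒≡ x y e) (sym (graph⇒≡ x′ y e′))))
    ... | false = ≤-reflexive (trans (sum-cong-≗ zeros) (trans (sum-const m 0) (*-zeroʳ m)))
      where
      zeros : ∀ x → ⟦ graph x y ⟧ ≡ 0
      zeros x with graph x y in e
      ... | false = refl
      ... | true with () ← trans (sym eq) (trans (cong B (sym (graph⇒≡ x y e))) (maps x (graph⇒A x y e)))

  enumerate : ∀ {n} (A : Fin n → Bool) → ∃ λ (w : Fin (# A) → Fin n) →
    (∀ i → A (w i) ≡ true) × (∀ i j → w i ≡ w j → i ≡ j) × (∀ x → A x ≡ true → ∃ λ i → w i ≡ x)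
  enumerate {zero} A = (λ ()) , (λ ()) , (λ ()) , λ ()
  enumerate {suc n} A with A zero in eq | enumerate (A ∘ suc)
  ... | false | w , p , q , r = suc ∘ w , p , (λ i j e → q i j (Fin.suc-injective e)) , onto
    where
    onto : ∀ x → A x ≡ true → ∃ λ i → suc (w i) ≡ x
    onto zero e with () ← trans (sym eq) e
    onto (suc x) e with r x e
    ... | i , refl = i , refl
  ... | true | w , p , q , r = w′ , p′ , q′ , onto
    where
    w′ : Fin (suc (# (A ∘ suc))) → Fin (suc n)
    w′ zero = zero
    w′ (suc i) = suc (w i)
    p′ : ∀ i → A (w′ i) ≡ true
    p′ zero = eq
    p′ (suc i) = p i
    q′ : ∀ i j → w′ i ≡ w′ j → i ≡ j
    q′ zero zero e = refl
    q′ (suc i) (suc j) e = cong suc (q i j (Fin.suc-injective e))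
    onto : ∀ x → A x ≡ true → ∃ λ i → w′ i ≡ x
    onto zero e = zero , refl
    onto (suc x) e with r x e
    ... | i , refl = suc i , refl

  -- `D` is the reciprocal of a density. For a set of size at least `q / D`, at most `8 * m * m * D`
  -- elements are bad, so `n` bad sets can cover another such set only if
  -- `q ≤ n * (8 * m * m * D) * D`; the successor rules this out. The recursive summand provides for
  -- the next round, where densities have dropped by a factor `2 * m`.
  threshold : (m n D : ℕ) → ℕ
  threshold m zero D = 0
  threshold m (suc n) D = suc (n * (8 * m * m * D) * D + threshold m n (2 * m * D))

  module SecondMoment {m e q : ℕ} (ρ : Fin m → Fin q → Fin q → Bool) (q≡ : q ≡ suc (m * e))
    (degree : ∀ i a → sum (λ b → ⟦ ρ i b a ⟧) ≡ e)
    (codegree : ∀ a a′ → a ≢ a′ → sum (λ i → sum (λ b → ⟦ ρ i b a ⟧ * ⟦ ρ i b a′ ⟧)) ≤ e) where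

    neighbours : (Fin q → Bool) → Fin m → Fin q → Fin q → Bool
    neighbours A i b a = A a ∧ ρ i b a

    N : (Fin q → Bool) → Fin m → Fin q → ℕ
    N A i b = # (neighbours A i b)

    -- The fair share of a neighbourhood in `A` is `# A / m`; bad means at most half of it.
    bad? : ∀ A i b → Dec (2 * m * N A i b ≤ # A)
    bad? A i b = 2 * m * N A i b ≤? # A

    bad : (Fin q → Bool) → Fin m → Fin q → Bool
    bad A i b = does (bad? A i b)

    module _ (A : Fin q → Bool) where

      private
        S : ℕ
        S = # A
        α : Fin q → ℕ
        α a = ⟦ A a ⟧
        r : Fin m → Fin q → Fin q → ℕ
        r i b a = ⟦ ρ i b a ⟧

        N≡ : ∀ i b → N A i b ≡ sum (λ a → α a * r i b a)
        N≡ i b = sum-cong-≗ (λ a → ⟦∧⟧ (A a) (ρ i b a))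

      first-moment : ∀ i → sum (N A i) ≡ S * e
      first-moment i = begin
        sum (N A i)                              ≡⟨ sum-cong-≗ (N≡ i) ⟩
        sum (λ b → sum (λ a → α a * r i b a))    ≡⟨ ∑-comm (λ b a → α a * r i b a) ⟩
        sum (λ a → sum (λ b → α a * r i b a))    ≡⟨ sum-cong-≗ (λ a → sym (*-distribˡ-sum (α a) (λ b → r i b a))) ⟩
        sum (λ a → α a * sum (λ b → r i b a))    ≡⟨ sum-cong-≗ (λ a → cong (α a *_) (degree i a)) ⟩
        sum (λ a → α a * e)                      ≡⟨ *-distribʳ-sum e α ⟨
        S * e                                    ∎
        where open ≡-Reasoning

      sq-sum : ∀ {n} (f : Fin n → ℕ) → sum f * sum f ≡ sum (λ a → sum (λ a′ → f a * f a′))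
      sq-sum f = trans (*-distribʳ-sum (sum f) f) (sum-cong-≗ (λ a → *-distribˡ-sum (f a) f))

      δ : Fin q → Fin q → ℕ
      δ a a′ = ⟦ does (a Fin.≟ a′) ⟧

      codegree′ : ∀ a a′ → sum (λ i → sum (λ b → r i b a * r i b a′)) ≤ m * e * δ a a′ + e
      codegree′ a a′ with a Fin.≟ a′
      ... | no a≢a′ = ≤-trans (codegree a a′ a≢a′) (m≤n+m e _)
      ... | yes refl = ≤-trans (≤-reflexive (trans (sum-cong-≗ (λ i → trans (sum-cong-≗ (λ b → ⟦⟧-idem (ρ i b a))) (degree i a)))
                         (trans (sum-const m e) (sym (*-identityʳ (m * e)))))) (m≤m+n _ e)

      diagonal : sum (λ a → sum (λ a′ → α a * α a′ * δ a a′)) ≤ S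
      diagonal = sum-mono row
        where
        row : ∀ a → sum (λ a′ → α a * α a′ * δ a a′) ≤ α a
        row a = begin
          sum (λ a′ → α a * α a′ * δ a a′)    ≤⟨ sum-mono (λ a′ → *-monoˡ-≤ (δ a a′) (≤-trans (*-monoʳ-≤ (α a) (⟦⟧≤1 (A a′))) (≤-reflexive (*-identityʳ (α a))))) ⟩
          sum (λ a′ → α a * δ a a′)           ≡⟨ *-distribˡ-sum (α a) (δ a) ⟨
          α a * sum (δ a)                     ≤⟨ *-monoʳ-≤ (α a) (#≤1 (λ a′ → does (a Fin.≟ a′)) uniq) ⟩
          α a * 1                             ≡⟨ *-identityʳ (α a) ⟩
          α a                                 ∎
          where
          open ≤-Reasoning
          uniq : ∀ x y → does (a Fin.≟ x) ≡ true → does (a Fin.≟ y) ≡ true → x ≡ y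
          uniq x y u v with a Fin.≟ x | a Fin.≟ y
          ... | yes refl | yes refl = refl

      -- The square of `N A i b` counts pairs `a`, `a′` of common neighbours in `A`. Summed over `i`
      -- and `b`, a pair with `a = a′` occurs `m * e` times, any other pair at most `e` times.
      second-moment : sum (λ i → sum (λ b → N A i b * N A i b)) ≤ S * (m * e) + S * S * e
      second-moment = begin
        sum (λ i → sum (λ b → N A i b * N A i b))
          ≡⟨ sum-cong-≗ (λ i → sum-cong-≗ (λ b → trans (cong (λ z → z * z) (N≡ i b)) (sq-sum (λ a → α a * r i b a)))) ⟩
        sum (λ i → sum (λ b → sum (λ a → sum (λ a′ → α a * r i b a * (α a′ * r i b a′)))))
          ≡⟨ sum-cong-≗ (λ i → ∑-comm (λ b a → sum (λ a′ → α a * r i b a * (α a′ * r i b a′)))) ⟩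
        sum (λ i → sum (λ a → sum (λ b → sum (λ a′ → α a * r i b a * (α a′ * r i b a′)))))
          ≡⟨ ∑-comm (λ i a → sum (λ b → sum (λ a′ → α a * r i b a * (α a′ * r i b a′)))) ⟩
        sum (λ a → sum (λ i → sum (λ b → sum (λ a′ → α a * r i b a * (α a′ * r i b a′)))))
          ≡⟨ sum-cong-≗ (λ a → sum-cong-≗ (λ i → ∑-comm (λ b a′ → α a * r i b a * (α a′ * r i b a′)))) ⟩
        sum (λ a → sum (λ i → sum (λ a′ → sum (λ b → α a * r i b a * (α a′ * r i b a′)))))
          ≡⟨ sum-cong-≗ (λ a → ∑-comm (λ i a′ → sum (λ b → α a * r i b a * (α a′ * r i b a′)))) ⟩
        sum (λ a → sum (λ a′ → sum (λ i → sum (λ b → α a * r i b a * (α a′ * r i b a′)))))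
          ≡⟨ sum-cong-≗ (λ a → sum-cong-≗ (λ a′ → pull a a′)) ⟩
        sum (λ a → sum (λ a′ → α a * α a′ * sum (λ i → sum (λ b → r i b a * r i b a′))))
          ≤⟨ sum-mono (λ a → sum-mono (λ a′ → *-monoʳ-≤ (α a * α a′) (codegree′ a a′))) ⟩
        sum (λ a → sum (λ a′ → α a * α a′ * (m * e * δ a a′ + e)))
          ≡⟨ sum-cong-≗ (λ a → trans (sum-cong-≗ (λ a′ → expand (α a) (α a′) (m * e) (δ a a′) e))
               (∑-distrib-+ (λ a′ → α a * α a′ * δ a a′ * (m * e)) (λ a′ → α a * α a′ * e))) ⟩
        sum (λ a → sum (λ a′ → α a * α a′ * δ a a′ * (m * e)) + sum (λ a′ → α a * α a′ * e))
          ≡⟨ ∑-distrib-+ (λ a → sum (λ a′ → α a * α a′ * δ a a′ * (m * e))) (λ a → sum (λ a′ → α a * α a′ * e)) ⟩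
        sum (λ a → sum (λ a′ → α a * α a′ * δ a a′ * (m * e))) + sum (λ a → sum (λ a′ → α a * α a′ * e))
          ≡⟨ cong₂ _+_ (sum-* (λ a a′ → α a * α a′ * δ a a′) (m * e)) (trans (sum-* (λ a a′ → α a * α a′) e) (cong (_* e) (sym (sq-sum α)))) ⟩
        sum (λ a → sum (λ a′ → α a * α a′ * δ a a′)) * (m * e) + S * S * e
          ≤⟨ +-monoˡ-≤ (S * S * e) (*-monoˡ-≤ (m * e) diagonal) ⟩
        S * (m * e) + S * S * e ∎
        where
        open ≤-Reasoning
        shuffle : ∀ a b c d → a * b * (c * d) ≡ a * c * (b * d)
        shuffle = solve-∀
        expand : ∀ a b c d e → a * b * (c * d + e) ≡ a * b * d * c + a * b * e
        expand = solve-∀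
        sum-* : ∀ {n n′} (f : Fin n → Fin n′ → ℕ) c → sum (λ a → sum (λ a′ → f a a′ * c)) ≡ sum (λ a → sum (f a)) * c
        sum-* f c = trans (sum-cong-≗ (λ a → sym (*-distribʳ-sum c (f a)))) (sym (*-distribʳ-sum c (λ a → sum (f a))))
        pull : ∀ a a′ → sum (λ i → sum (λ b → α a * r i b a * (α a′ * r i b a′))) ≡ α a * α a′ * sum (λ i → sum (λ b → r i b a * r i b a′))
        pull a a′ = trans (sum-cong-≗ (λ i → trans (sum-cong-≗ (λ b → shuffle (α a) (r i b a) (α a′) (r i b a′)))
          (sym (*-distribˡ-sum (α a * α a′) (λ b → r i b a * r i b a′))))) (sym (*-distribˡ-sum (α a * α a′) (λ i → sum (λ b → r i b a * r i b a′))))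

      private
        -- This is Chebyshev's inequality at one point without subtraction: the square of
        -- `2 * S - 2 * m * N A i b` is nonnegative, and at a bad point it is at least `S * S`.
        pointwise : ∀ i b (d : Dec (2 * m * N A i b ≤ S)) →
          8 * m * S * N A i b + ⟦ does d ⟧ * (S * S) ≤ 4 * m * m * (N A i b * N A i b) + 4 * S * S
        pointwise i b (yes u≤S) with m≤n⇒∃[o]m+o≡n u≤S
        ... | t , eq = m+n≤o⇒m≤o _ (≤-reflexive (identity m (N A i b) S t (sym eq)))
          where
          identity : ∀ m n s t → s ≡ 2 * m * n + t →
            8 * m * s * n + 1 * (s * s) + (2 * s * t + t * t) ≡ 4 * m * m * (n * n) + 4 * s * s
          identity m n s t refl = lem m n t
            where
            lem : ∀ m n t → let s = 2 * m * n + t in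
              8 * m * s * n + 1 * (s * s) + (2 * s * t + t * t) ≡ 4 * m * m * (n * n) + 4 * s * s
            lem = solve-∀
        pointwise i b (no _) = subst₂ _≤_ (lem₁ m (N A i b) S) (lem₂ m (N A i b) S) (2xy≤x²+y² (2 * m * N A i b) (2 * S))
          where
          lem₁ : ∀ m n s → 2 * (2 * m * n * (2 * s)) ≡ 8 * m * s * n + 0 * (s * s)
          lem₁ = solve-∀
          lem₂ : ∀ m n s → 2 * m * n * (2 * m * n) + 2 * s * (2 * s) ≡ 4 * m * m * (n * n) + 4 * s * s
          lem₂ = solve-∀
          2xy≤ : ∀ x t → 2 * (x * (x + t)) ≤ x * x + (x + t) * (x + t)
          2xy≤ x t = m+n≤o⇒m≤o _ (≤-reflexive (lem x t))
            where
            lem : ∀ x t → 2 * (x * (x + t)) + t * t ≡ x * x + (x + t) * (x + t)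
            lem = solve-∀
          2xy≤x²+y² : ∀ x y → 2 * (x * y) ≤ x * x + y * y
          2xy≤x²+y² x y with ≤-total x y
          ... | inj₁ x≤y with m≤n⇒∃[o]m+o≡n x≤y
          ...   | t , refl = 2xy≤ x t
          2xy≤x²+y² x y | inj₂ y≤x with m≤n⇒∃[o]m+o≡n y≤x
          ...   | t , refl = subst₂ _≤_ (cong (2 *_) (*-comm y x)) (+-comm (y * y) (x * x)) (2xy≤ y t)

        Bad : ℕ
        Bad = sum (λ i → # (bad A i))

        total : 8 * m * S * (m * (S * e)) + Bad * (S * S) ≤ 4 * m * m * (S * (m * e) + S * S * e) + 4 * S * S * (m * q)
        total = begin
          8 * m * S * (m * (S * e)) + Bad * (S * S)
            ≡⟨ cong₂ _+_ (sym left₁) (trans (*-distribʳ-sum (S * S) (λ i → # (bad A i))) (sum-cong-≗ (λ i → *-distribʳ-sum (S * S) (λ b → ⟦ bad A i b ⟧)))) ⟩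
          sum (λ i → sum (λ b → 8 * m * S * N A i b)) + sum (λ i → sum (λ b → ⟦ bad A i b ⟧ * (S * S)))
            ≡⟨ sum₂-+ (λ i b → 8 * m * S * N A i b) (λ i b → ⟦ bad A i b ⟧ * (S * S)) ⟨
          sum (λ i → sum (λ b → 8 * m * S * N A i b + ⟦ bad A i b ⟧ * (S * S)))
            ≤⟨ sum-mono (λ i → sum-mono (λ b → pointwise i b (bad? A i b))) ⟩
          sum (λ i → sum (λ b → 4 * m * m * (N A i b * N A i b) + 4 * S * S))
            ≡⟨ sum₂-+ (λ i b → 4 * m * m * (N A i b * N A i b)) (λ _ _ → 4 * S * S) ⟩
          sum (λ i → sum (λ b → 4 * m * m * (N A i b * N A i b))) + sum {m} (λ i → sum {q} (λ b → 4 * S * S))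
            ≡⟨ cong₂ _+_ (sum₂-* (4 * m * m) (λ i b → N A i b * N A i b))
                 (trans (sum-cong-≗ {m} (λ _ → sum-const q (4 * S * S))) (trans (sum-const m (q * (4 * S * S))) (assoc m q (4 * S * S)))) ⟩
          4 * m * m * sum (λ i → sum (λ b → N A i b * N A i b)) + 4 * S * S * (m * q)
            ≤⟨ +-monoˡ-≤ (4 * S * S * (m * q)) (*-monoʳ-≤ (4 * m * m) second-moment) ⟩
          4 * m * m * (S * (m * e) + S * S * e) + 4 * S * S * (m * q) ∎
          where
          open ≤-Reasoning
          assoc : ∀ m q s → m * (q * s) ≡ s * (m * q)
          assoc = solve-∀
          sum₂-+ : ∀ {n n′} (f g : Fin n → Fin n′ → ℕ) → sum (λ i → sum (λ b → f i b + g i b)) ≡ sum (λ i → sum (f i)) + sum (λ i → sum (g i))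
          sum₂-+ f g = trans (sum-cong-≗ (λ i → ∑-distrib-+ (f i) (g i))) (∑-distrib-+ (λ i → sum (f i)) (λ i → sum (g i)))
          sum₂-* : ∀ {n n′} c (f : Fin n → Fin n′ → ℕ) → sum (λ i → sum (λ b → c * f i b)) ≡ c * sum (λ i → sum (f i))
          sum₂-* c f = trans (sum-cong-≗ (λ i → sym (*-distribˡ-sum c (f i)))) (sym (*-distribˡ-sum c (λ i → sum (f i))))
          left₁ : sum (λ i → sum (λ b → 8 * m * S * N A i b)) ≡ 8 * m * S * (m * (S * e))
          left₁ = trans (sum₂-* (8 * m * S) (λ i b → N A i b)) (cong (8 * m * S *_) (trans (sum-cong-≗ first-moment) (sum-const m (S * e))))

      -- With `q = 1 + m * e` the terms in `S * S * e` on the two sides of `total` cancel exactly;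
      -- this is where the codegree bound has to be as sharp as `e`. What remains is divisible by
      -- `S` and of order `q`.
      #bad : 0 < S → ∀ i → # (bad A i) * S ≤ 8 * m * m * q
      #bad 0<S i = begin
        # (bad A i) * S                 ≤⟨ *-monoˡ-≤ S (term≤sum (λ i → # (bad A i)) i) ⟩
        Bad * S                         ≤⟨ *-cancelˡ-≤ S {{>-nonZero 0<S}} cancelled ⟩
        4 * m * m * (m * e) + 4 * m * S ≤⟨ +-mono-≤ (*-monoʳ-≤ (4 * m * m) me≤q) (*-mono-≤ (≤-trans (m≤m*n (4 * m) m {{m≢0}}) ≤-refl) (#≤n A)) ⟩
        4 * m * m * q + 4 * m * m * q   ≡⟨ lem m q ⟩
        8 * m * m * q                   ∎
        where
        open ≤-Reasoning
        m≢0 : NonZero m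
        m≢0 = Fin.nonZeroIndex i
        me≤q : m * e ≤ q
        me≤q = ≤-trans (n≤1+n (m * e)) (≤-reflexive (sym q≡))
        lem : ∀ m q → 4 * m * m * q + 4 * m * m * q ≡ 8 * m * m * q
        lem = solve-∀
        left : ∀ m s e b → 8 * m * s * (m * (s * e)) + b * (s * s) ≡ 8 * m * s * (m * (s * e)) + s * (b * s)
        left = solve-∀
        right : ∀ m s e → 4 * m * m * (s * (m * e) + s * s * e) + 4 * s * s * (m * suc (m * e))
          ≡ 8 * m * s * (m * (s * e)) + s * (4 * m * m * (m * e) + 4 * m * s)
        right = solve-∀
        cancelled : S * (Bad * S) ≤ S * (4 * m * m * (m * e) + 4 * m * S)
        cancelled = +-cancelˡ-≤ (8 * m * S * (m * (S * e))) _ _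
          (subst₂ _≤_ (left m S e Bad) (trans (cong (λ z → 4 * m * m * (S * (m * e) + S * S * e) + 4 * S * S * (m * z)) q≡) (right m S e)) total)

    -- The candidate sets A j keep density at least 1 / D; an element of A zero
    -- that is bad for none of the others costs each of them a factor 2 * m.
    choose : ∀ n D (A : Fin n → Fin q → Bool) (c : Fin n → Fin n → Fin m) →
      (∀ j → q ≤ # (A j) * D) → threshold m n D ≤ q →
      ∃ λ (b : Fin n → Fin q) → (∀ j → A j (b j) ≡ true) × (∀ i j → i Fin.< j → ρ (c i j) (b i) (b j) ≡ true)
    choose zero D A c dense big = (λ ()) , (λ ()) , λ ()
    choose (suc n) D A c dense big with Fin.any? (λ x → (A zero x Bool.≟ true) ×-dec Fin.all? (λ j → ¬? (bad? (A (suc j)) (c zero (suc j)) x)))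
    ... | no none = ⊥-elim (<-irrefl refl (≤-trans (s≤s small) (≤-trans (s≤s (m≤m+n _ _)) big)))
      where
      K = 8 * m * m * D
      instance
        q≢0 : NonZero q
        q≢0 = >-nonZero (≤-trans z<s big)
      bad_j : Fin n → Fin q → Bool
      bad_j j = bad (A (suc j)) (c zero (suc j))
      #bad≤K : ∀ j → # (bad_j j) ≤ K
      #bad≤K j = *-cancelʳ-≤ _ _ q (begin
        # (bad_j j) * q              ≤⟨ *-monoʳ-≤ (# (bad_j j)) (dense (suc j)) ⟩
        # (bad_j j) * (# Aj * D)     ≡⟨ *-assoc (# (bad_j j)) (# Aj) D ⟨
        # (bad_j j) * # Aj * D       ≤⟨ *-monoˡ-≤ D (#bad Aj (n≢0⇒n>0 Aj≢0) (c zero (suc j))) ⟩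
        8 * m * m * q * D            ≡⟨ lem (8 * m * m) q D ⟩
        K * q                        ∎)
        where
        open ≤-Reasoning
        Aj = A (suc j)
        Aj≢0 : # Aj ≢ 0
        Aj≢0 e = ≢-nonZero⁻¹ q (n≤0⇒n≡0 (≤-trans (dense (suc j)) (≤-reflexive (cong (_* D) e))))
        lem : ∀ a b c → a * b * c ≡ a * c * b
        lem = solve-∀
      covered : ∀ x → ⟦ A zero x ⟧ ≤ sum (λ j → ⟦ bad_j j x ⟧)
      covered x with A zero x in eq
      ... | false = z≤n
      ... | true with Fin.¬∀⟶∃¬ n _ (λ j → ¬? (bad? (A (suc j)) (c zero (suc j)) x)) (λ all → none (x , eq , all))
      ...   | j , ¬¬bad = #≥1 (λ j → bad_j j x) j (dec-true (bad? (A (suc j)) (c zero (suc j)) x) (decidable-stable (bad? _ _ x) ¬¬bad))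
      small : q ≤ n * K * D
      small = ≤-trans (dense zero) (*-monoˡ-≤ D (begin
        # (A zero)                                      ≤⟨ sum-mono covered ⟩
        sum (λ x → sum (λ j → ⟦ bad_j j x ⟧))           ≡⟨ ∑-comm (λ x j → ⟦ bad_j j x ⟧) ⟩
        sum (λ j → # (bad_j j))                         ≤⟨ sum-mono #bad≤K ⟩
        sum {n} (λ j → K)                               ≡⟨ sum-const n K ⟩
        n * K                                           ∎))
        where open ≤-Reasoning
    ... | yes (x , Ax , good) with choose n (2 * m * D) (λ j → neighbours (A (suc j)) (c zero (suc j)) x)
                                     (λ i j → c (suc i) (suc j)) dense′ (≤-trans (≤-trans (m≤n+m _ _) (n≤1+n _)) big)
      where
      dense′ : ∀ j → q ≤ # (neighbours (A (suc j)) (c zero (suc j)) x) * (2 * m * D)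
      dense′ j = ≤-trans (dense (suc j)) (≤-trans (*-monoˡ-≤ D (<⇒≤ (≰⇒> (good j))))
        (≤-reflexive (lem m (N (A (suc j)) (c zero (suc j)) x) D)))
        where
        lem : ∀ m n d → 2 * m * n * d ≡ n * (2 * m * d)
        lem = solve-∀
    ...   | b , b∈ , edge = b′ , b′∈ , edge′
      where
      ∧-trueˡ : ∀ {x y} → x ∧ y ≡ true → x ≡ true
      ∧-trueˡ {true} _ = refl
      ∧-trueʳ : ∀ {x y} → x ∧ y ≡ true → y ≡ true
      ∧-trueʳ {true} e = e
      b′ : Fin (suc n) → Fin q
      b′ zero = x
      b′ (suc j) = b j
      b′∈ : ∀ j → A j (b′ j) ≡ true
      b′∈ zero = Ax
      b′∈ (suc j) = ∧-trueˡ (b∈ j)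
      edge′ : ∀ i j → i Fin.< j → ρ (c i j) (b′ i) (b′ j) ≡ true
      edge′ zero (suc j) _ = ∧-trueʳ {A (suc j) (b j)} (b∈ j)
      edge′ (suc i) (suc j) i<j = edge i j (≤-pred i<j)

-- Power classes in a finite field, and differences in prescribed classes.

module Cyclotomy where

  open FiniteFields
  open Counting
  open import Data.Nat as ℕ using (ℕ; zero; suc; NonZero)
  import Data.Nat.Properties as ℕ
  open import Data.Fin as Fin using (Fin; zero; suc; punchIn)
  import Data.Fin.Properties as Fin
  open import Data.Fin.Permutation using (permutation)
  open import Data.Vec using (Vec; []; _∷_)
  open import Data.Vec.Functional using (removeAt)
  open import Data.Bool using (Bool; true; false; _∧_)
  import Data.Bool.Properties as Bool
  open import Data.Product using (∃; _×_; _,_; proj₁; proj₂)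
  open import Data.Empty using (⊥-elim)
  open import Function using (_∘_)
  open import Relation.Nullary using (Dec; yes; no; does; ¬?)
  open import Relation.Nullary.Decidable using (dec-true; _×-dec_)
  open import Relation.Binary.PropositionalEquality
  open import Algebra.Bundles using (CommutativeRing)
  import Algebra.Properties.CommutativeMonoid.Sum as Product
  import Algebra.Properties.CommutativeSemiring.Exp as Exp
  import Algebra.Properties.Semiring.Exp as SExp
  import Algebra.Properties.Ring as RingProperties

  does-true : ∀ {P : Set} (P? : Dec P) → does P? ≡ true → P
  does-true (yes p) _ = p

  module FieldTheory {q : ℕ} (K : Field (suc q)) where

    open Field K public
    open CommutativeRing commutativeRing public
      using (+-assoc; +-comm; +-identityˡ; +-identityʳ; -‿inverseˡ; -‿inverseʳ; *-assoc; *-comm; *-identityˡ; *-identityʳ;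
             distribˡ; distribʳ; zeroˡ; zeroʳ; *-commutativeMonoid; commutativeSemiring; semiring; ring)
    open Exp commutativeSemiring public using (_^_; ^-distrib-*)
    open SExp semiring public using (^-assocʳ)
    open RingProperties ring public using (-‿distribˡ-*; -‿involutive; x∙y⁻¹≈ε⇒x≈y; -‿+-comm)
    module ∏ = Product *-commutativeMonoid
    open ∏ public using () renaming (sum to ∏)

    infix 4 _≟_
    _≟_ : (x y : Fin (suc q)) → Dec (x ≡ y)
    _≟_ = Fin._≟_

    *-cancelˡ : ∀ x {y z} → x ≢ 0# → x * y ≡ x * z → y ≡ z
    *-cancelˡ x {y} {z} x≢0 e with ∃-inverse x x≢0
    ... | x⁻¹ , inv = begin
      y                ≡⟨ *-identityˡ y ⟨
      1# * y           ≡⟨ cong (_* y) inv ⟨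
      x⁻¹ * x * y      ≡⟨ *-assoc x⁻¹ x y ⟩
      x⁻¹ * (x * y)    ≡⟨ cong (x⁻¹ *_) e ⟩
      x⁻¹ * (x * z)    ≡⟨ *-assoc x⁻¹ x z ⟨
      x⁻¹ * x * z      ≡⟨ cong (_* z) inv ⟩
      1# * z           ≡⟨ *-identityˡ z ⟩
      z                ∎
      where open ≡-Reasoning

    *-cancelʳ : ∀ x {y z} → x ≢ 0# → y * x ≡ z * x → y ≡ z
    *-cancelʳ x {y} {z} x≢0 e = *-cancelˡ x x≢0 (trans (*-comm x y) (trans e (*-comm z x)))

    *-nonzero : ∀ {x y} → x ≢ 0# → y ≢ 0# → x * y ≢ 0#
    *-nonzero {x} x≢0 y≢0 e = y≢0 (*-cancelˡ x x≢0 (trans e (sym (zeroʳ x))))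

    ^-nonzero : ∀ {x} n → x ≢ 0# → x ^ n ≢ 0#
    ^-nonzero zero x≢0 = 1≢0
    ^-nonzero (suc n) x≢0 = *-nonzero x≢0 (^-nonzero n x≢0)

    0^ : ∀ n → .{{NonZero n}} → 0# ^ n ≡ 0#
    0^ (suc n) = zeroˡ (0# ^ n)

    1^ : ∀ n → 1# ^ n ≡ 1#
    1^ zero = refl
    1^ (suc n) = trans (*-identityˡ (1# ^ n)) (1^ n)

    -≢0 : ∀ {x} → x ≢ 0# → - x ≢ 0#
    -≢0 {x} x≢0 e = x≢0 (trans (sym (+-identityʳ x)) (trans (cong (x +_) (sym e)) (-‿inverseʳ x)))

    ∏-nonzero : ∀ {n} (f : Fin n → Fin (suc q)) → (∀ i → f i ≢ 0#) → ∏ f ≢ 0#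
    ∏-nonzero {zero} f h = 1≢0
    ∏-nonzero {suc n} f h = *-nonzero (h zero) (∏-nonzero (f ∘ suc) (h ∘ suc))

    ∏-const : ∀ n a → ∏ {n} (λ _ → a) ≡ a ^ n
    ∏-const zero a = refl
    ∏-const (suc n) a = cong (a *_) (∏-const n a)

    -- Multiplication by a permutes the nonzero elements, so it does not change their product.
    fermat : ∀ a → a ≢ 0# → a ^ q ≡ 1#
    fermat a a≢0 = begin
      a ^ q                      ≡⟨ ∏-const q a ⟨
      ∏ {q} (λ _ → a)            ≡⟨ ∏.sum-cong-≗ (λ i → if-nonzero a (punchIn 0# i) (λ e → Fin.punchInᵢ≢i 0# i e)) ⟨
      ∏ (removeAt (factor a) 0#) ≡⟨ *-identityˡ _ ⟨
      1# * ∏ (removeAt (factor a) 0#) ≡⟨ cong (_* ∏ (removeAt (factor a) 0#)) (if-zero a) ⟨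
      factor a 0# * ∏ (removeAt (factor a) 0#) ≡⟨ ∏.sum-remove {i = 0#} (factor a) ⟨
      ∏ (factor a)               ≡⟨ *-cancelʳ (∏ unit) (∏-nonzero unit unit≢0) (trans (sym (∏.∑-distrib-+ (factor a) unit)) (trans (sym permuted) (sym (*-identityˡ _)))) ⟩
      1#                         ∎
      where
      open ≡-Reasoning
      a⁻¹ = proj₁ (∃-inverse a a≢0)
      inv = proj₂ (∃-inverse a a≢0)
      -- The value 1 at zero lets all products run over the whole field, which multiplication by `a`
      -- permutes.
      factor : Fin (suc q) → Fin (suc q) → Fin (suc q)
      factor z x with x ≟ 0#
      ... | yes _ = 1#
      ... | no _ = z
      if-nonzero : ∀ z x → x ≢ 0# → factor z x ≡ z
      if-nonzero z x x≢0 with x ≟ 0#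
      ... | yes e = ⊥-elim (x≢0 e)
      ... | no _ = refl
      if-zero : ∀ z → factor z 0# ≡ 1#
      if-zero z with 0# ≟ 0#
      ... | yes _ = refl
      ... | no ne = ⊥-elim (ne refl)
      unit : Fin (suc q) → Fin (suc q)
      unit x = factor x x
      unit≢0 : ∀ x → unit x ≢ 0#
      unit≢0 x with x ≟ 0#
      ... | yes _ = 1≢0
      ... | no x≢0 = x≢0
      unit-* : ∀ x → unit (a * x) ≡ factor a x * unit x
      unit-* x with x ≟ 0#
      ... | yes refl = trans (cong unit (zeroʳ a)) (trans (if-zero 0#) (sym (*-identityˡ 1#)))
      ... | no x≢0 = if-nonzero (a * x) (a * x) (*-nonzero a≢0 x≢0)
      permuted : ∏ unit ≡ ∏ (λ x → factor a x * unit x)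
      permuted = trans (∏.sum-permute unit (permutation (a *_) (a⁻¹ *_)
        (λ x → trans (sym (*-assoc a a⁻¹ x)) (trans (cong (_* x) (trans (*-comm a a⁻¹) inv)) (*-identityˡ x)))
        (λ x → trans (sym (*-assoc a⁻¹ a x)) (trans (cong (_* x) inv) (*-identityˡ x)))))
        (∏.sum-cong-≗ unit-*)

    -- Constant term first; the leading coefficient 1 is not stored.
    eval : ∀ {n} → Vec (Fin (suc q)) n → Fin (suc q) → Fin (suc q)
    eval [] x = 1#
    eval (a ∷ as) x = a + x * eval as x

    -- Division by x - a, with both sides moved so that no subtraction occurs.
    synthetic-division : ∀ {n} (as : Vec (Fin (suc q)) (suc n)) a →
      ∃ λ (bs : Vec (Fin (suc q)) n) → ∀ x → eval as x + a * eval bs x ≡ x * eval bs x + eval as a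
    synthetic-division (c ∷ []) a = [] , λ x → lem c x a
      where
      open import Algebra.Solver.Ring.NaturalCoefficients.Default commutativeSemiring
      lem : ∀ c x a → c + x * 1# + a * 1# ≡ x * 1# + (c + a * 1#)
      lem = solve 3 (λ c x a → (c :+ x :* con 1) :+ a :* con 1 := x :* con 1 :+ (c :+ a :* con 1)) refl
    synthetic-division (c ∷ as@(_ ∷ _)) a with synthetic-division as a
    ... | bs , h = eval as a ∷ bs , λ x → trans (lem₁ c x a (eval as x) (eval as a) (eval bs x))
            (trans (cong (λ z → c + a * eval as a + x * z) (h x)) (lem₂ c x a (eval as a) (eval bs x)))
      where
      open import Algebra.Solver.Ring.NaturalCoefficients.Default commutativeSemiring
      lem₁ : ∀ c x a p r b → c + x * p + a * (r + x * b) ≡ c + a * r + x * (p + a * b)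
      lem₁ = solve 6 (λ c x a p r b → (c :+ x :* p) :+ a :* (r :+ x :* b) := (c :+ a :* r) :+ x :* (p :+ a :* b)) refl
      lem₂ : ∀ c x a r b → c + a * r + x * (x * b + r) ≡ x * (r + x * b) + (c + a * r)
      lem₂ = solve 5 (λ c x a r b → (c :+ a :* r) :+ x :* (x :* b :+ r) := x :* (r :+ x :* b) :+ (c :+ a :* r)) refl

    -- Divide by `x - a` for one root `a` in `A`; the others are roots of the quotient. Taking any
    -- set of roots for `A`, rather than all of them, lets the induction simply remove `a`, even
    -- when it is a multiple root.
    #roots : ∀ n (as : Vec (Fin (suc q)) n) (A : Fin (suc q) → Bool) → (∀ x → A x ≡ true → eval as x ≡ 0#) → # A ℕ.≤ n
    #roots n as A h with Fin.any? (λ x → A x Bool.≟ true)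
    ... | no none = ℕ.≤-trans (ℕ.≤-reflexive (trans (sum-cong-≗ zeros) (trans (sum-const (suc q) 0) (ℕ.*-zeroʳ (suc q))))) ℕ.z≤n
      where
      zeros : ∀ x → ⟦ A x ⟧ ≡ 0
      zeros x with A x in eq
      ... | false = refl
      ... | true = ⊥-elim (none (x , eq))
    #roots zero [] A h | yes (a , Aa) = ⊥-elim (1≢0 (h a Aa))
    #roots (suc n) as A h | yes (a , Aa) with synthetic-division as a
    ... | bs , div = begin
      # A                                                   ≤⟨ sum-mono split ⟩
      sum (λ x → ⟦ does (x ≟ a) ⟧ ℕ.+ ⟦ A′ x ⟧)             ≡⟨ ∑-distrib-+ (λ x → ⟦ does (x ≟ a) ⟧) (λ x → ⟦ A′ x ⟧) ⟩
      # (λ x → does (x ≟ a)) ℕ.+ # A′                       ≤⟨ ℕ.+-mono-≤ (#≤1 _ (λ x y e f → trans (does-true (x ≟ a) e) (sym (does-true (y ≟ a) f)))) (#roots n bs A′ roots′) ⟩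
      suc n                                                 ∎
      where
      open ℕ.≤-Reasoning
      A′ : Fin (suc q) → Bool
      A′ x = does (A x Bool.≟ true ×-dec ¬? (x ≟ a))
      split : ∀ x → ⟦ A x ⟧ ℕ.≤ ⟦ does (x ≟ a) ⟧ ℕ.+ ⟦ A′ x ⟧
      split x with A x | x ≟ a
      ... | false | _ = ℕ.z≤n
      ... | true | yes _ = ℕ.s≤s ℕ.z≤n
      ... | true | no _ = ℕ.s≤s ℕ.z≤n
      roots′ : ∀ x → A′ x ≡ true → eval bs x ≡ 0#
      roots′ x e with does-true (A x Bool.≟ true ×-dec ¬? (x ≟ a)) e
      ... | Ax , x≢a with eval bs x ≟ 0#
      ...   | yes e₀ = e₀
      ...   | no ne = ⊥-elim (x≢a (*-cancelʳ (eval bs x) ne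
              (trans (sym (+-identityʳ _)) (trans (cong (x * eval bs x +_) (sym (h a Aa))) (trans (sym (div x))
                (trans (cong (_+ a * eval bs x) (h x Ax)) (+-identityˡ _)))))))

    #power-fibre : ∀ n → .{{NonZero n}} → ∀ c → # (λ x → does (x ^ n ≟ c)) ℕ.≤ n
    #power-fibre (suc n) c = #roots (suc n) (- c ∷ zeros n) _ λ x e →
      trans (cong (λ z → - c + z) (trans (cong (x *_) (eval-zeros n x)) (does-true (x ^ suc n ≟ c) e))) (-‿inverseˡ c)
      where
      zeros : ∀ n → Vec (Fin (suc q)) n
      zeros zero = []
      zeros (suc n) = 0# ∷ zeros n
      eval-zeros : ∀ n x → eval (zeros n) x ≡ x ^ n
      eval-zeros zero x = refl
      eval-zeros (suc n) x = trans (+-identityˡ _) (cong (x *_) (eval-zeros n x))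

    infixl 6 _-_
    _-_ : Fin (suc q) → Fin (suc q) → Fin (suc q)
    x - y = x + - y

    x-y≡0⇒x≡y : ∀ x y → x - y ≡ 0# → x ≡ y
    x-y≡0⇒x≡y = x∙y⁻¹≈ε⇒x≈y

    [x-y]+y≡x : ∀ x y → x - y + y ≡ x
    [x-y]+y≡x x y = trans (+-assoc x (- y) y) (trans (cong (x +_) (-‿inverseˡ y)) (+-identityʳ x))

    +-cancelˡ : ∀ x {y z} → x + y ≡ x + z → y ≡ z
    +-cancelˡ x {y} {z} e = trans (sym (cancel y)) (trans (cong (- x +_) e) (cancel z))
      where
      cancel : ∀ y → - x + (x + y) ≡ y
      cancel y = trans (sym (+-assoc (- x) x y)) (trans (cong (_+ y) (-‿inverseˡ x)) (+-identityˡ y))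

    +-cancelʳ : ∀ x {y z} → y + x ≡ z + x → y ≡ z
    +-cancelʳ x {y} {z} e = +-cancelˡ x (trans (+-comm x y) (trans e (+-comm z x)))

    x-[x-y]≡y : ∀ x y → x - (x - y) ≡ y
    x-[x-y]≡y x y = +-cancelʳ (x - y) (trans ([x-y]+y≡x x (x - y)) (trans (sym ([x-y]+y≡x x y)) (+-comm (x - y) y)))

    -1≢0 : - 1# ≢ 0#
    -1≢0 = -≢0 1≢0

    -1*-1 : - 1# * - 1# ≡ 1#
    -1*-1 = trans (sym (-‿distribˡ-* 1# (- 1#))) (trans (cong -_ (*-identityˡ (- 1#))) (-‿involutive 1#))

    -1^even : ∀ t → (- 1#) ^ (2 ℕ.* t) ≡ 1#
    -1^even t = trans (sym (^-assocʳ (- 1#) 2 t)) (trans (cong (_^ t) (trans (cong (- 1# *_) (*-identityʳ (- 1#))) -1*-1)) (1^ t))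

    neg-difference : ∀ x y → y - x ≡ - 1# * (x - y)
    neg-difference x y = sym (trans (sym (-‿distribˡ-* 1# (x - y))) (trans (cong -_ (*-identityˡ (x - y)))
      (trans (sym (-‿+-comm x (- y))) (trans (cong (- x +_) (-‿involutive y)) (+-comm (- x) y)))))

    infix 9 _⁻¹
    _⁻¹ : Fin (suc q) → Fin (suc q)
    x ⁻¹ with x ≟ 0#
    ... | yes _ = 0#
    ... | no x≢0 = proj₁ (∃-inverse x x≢0)

    *-inverseˡ : ∀ x → x ≢ 0# → x ⁻¹ * x ≡ 1#
    *-inverseˡ x x≢0 with x ≟ 0#
    ... | yes e = ⊥-elim (x≢0 e)
    ... | no ne = proj₂ (∃-inverse x ne)

    *-inverseʳ : ∀ x → x ≢ 0# → x * x ⁻¹ ≡ 1#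
    *-inverseʳ x x≢0 = trans (*-comm x (x ⁻¹)) (*-inverseˡ x x≢0)

    module Classes (m e : ℕ) .{{m≢0 : NonZero m}} .{{e≢0 : NonZero e}} (q≡ : q ≡ m ℕ.* e) where

      μ : Fin (suc q) → Bool
      μ y = does (y ^ m ≟ 1#)

      fibre : Fin (suc q) → Fin (suc q) → Bool
      fibre y x = does (x ^ e ≟ y)

      ^e∈μ : ∀ x → x ≢ 0# → (x ^ e) ^ m ≡ 1#
      ^e∈μ x x≢0 = trans (^-assocʳ x e m) (trans (cong (x ^_) (trans (ℕ.*-comm e m) (sym q≡))) (fermat x x≢0))

      private
        fibre-sum : Fin (suc q) → ℕ
        fibre-sum y = ⟦ μ y ⟧ ℕ.* # (fibre y)

        q≤fibres : q ℕ.≤ sum fibre-sum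
        q≤fibres = begin
          q                                                        ≤⟨ ℕ.+-cancelˡ-≤ 1 _ _ nonzero ⟩
          sum (λ x → ⟦ does (¬? (x ≟ 0#)) ⟧)                       ≤⟨ sum-mono covered ⟩
          sum (λ x → sum (λ y → ⟦ μ y ⟧ ℕ.* ⟦ fibre y x ⟧))        ≡⟨ ∑-comm (λ x y → ⟦ μ y ⟧ ℕ.* ⟦ fibre y x ⟧) ⟩
          sum (λ y → sum (λ x → ⟦ μ y ⟧ ℕ.* ⟦ fibre y x ⟧))        ≡⟨ sum-cong-≗ (λ y → sym (*-distribˡ-sum ⟦ μ y ⟧ (λ x → ⟦ fibre y x ⟧))) ⟩
          sum fibre-sum                                            ∎
          where
          open ℕ.≤-Reasoning
          nonzero : suc q ℕ.≤ 1 ℕ.+ sum (λ x → ⟦ does (¬? (x ≟ 0#)) ⟧)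
          nonzero = begin
            suc q                                                                     ≡⟨ trans (sum-const (suc q) 1) (ℕ.*-identityʳ (suc q)) ⟨
            sum {suc q} (λ _ → 1)                                                     ≤⟨ sum-mono split ⟩
            sum (λ x → ⟦ does (x ≟ 0#) ⟧ ℕ.+ ⟦ does (¬? (x ≟ 0#)) ⟧)                  ≡⟨ ∑-distrib-+ (λ x → ⟦ does (x ≟ 0#) ⟧) (λ x → ⟦ does (¬? (x ≟ 0#)) ⟧) ⟩
            # (λ x → does (x ≟ 0#)) ℕ.+ sum (λ x → ⟦ does (¬? (x ≟ 0#)) ⟧)            ≤⟨ ℕ.+-monoˡ-≤ _ (#≤1 _ (λ x y e f → trans (does-true (x ≟ 0#) e) (sym (does-true (y ≟ 0#) f)))) ⟩
            1 ℕ.+ sum (λ x → ⟦ does (¬? (x ≟ 0#)) ⟧)                                  ∎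
            where
            split : ∀ x → 1 ℕ.≤ ⟦ does (x ≟ 0#) ⟧ ℕ.+ ⟦ does (¬? (x ≟ 0#)) ⟧
            split x with x ≟ 0#
            ... | yes _ = ℕ.≤-refl
            ... | no _ = ℕ.≤-refl
          covered : ∀ x → ⟦ does (¬? (x ≟ 0#)) ⟧ ℕ.≤ sum (λ y → ⟦ μ y ⟧ ℕ.* ⟦ fibre y x ⟧)
          covered x with x ≟ 0#
          ... | yes _ = ℕ.z≤n
          ... | no x≢0 = ℕ.≤-trans (ℕ.≤-reflexive (sym (cong₂ (λ a b → ⟦ a ⟧ ℕ.* ⟦ b ⟧)
                  (dec-true ((x ^ e) ^ m ≟ 1#) (^e∈μ x x≢0)) (dec-true (x ^ e ≟ x ^ e) refl))))
                (term≤sum (λ y → ⟦ μ y ⟧ ℕ.* ⟦ fibre y x ⟧) (x ^ e))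

        fibre-sum≤ : ∀ y → fibre-sum y ℕ.≤ ⟦ μ y ⟧ ℕ.* e
        fibre-sum≤ y = ℕ.*-monoʳ-≤ ⟦ μ y ⟧ (#power-fibre e y)

        #μ*e : sum (λ y → ⟦ μ y ⟧ ℕ.* e) ≡ # μ ℕ.* e
        #μ*e = sym (*-distribʳ-sum e (λ y → ⟦ μ y ⟧))

      -- By Fermat every nonzero `x` lies in a fibre over `μ`, so `q ≤ # μ * e`. The polynomial root
      -- bounds are `m` for `μ` and `e` for a fibre, and `q = m * e`, so both are attained; `#fibre`
      -- is the other half of this argument.
      #μ : # μ ≡ m
      #μ = ℕ.≤-antisym (#power-fibre m 1#) (ℕ.*-cancelʳ-≤ m (# μ) e
        (ℕ.≤-trans (ℕ.≤-reflexive (sym q≡)) (ℕ.≤-trans q≤fibres (ℕ.≤-trans (sum-mono fibre-sum≤) (ℕ.≤-reflexive #μ*e)))))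

      #fibre : ∀ y → y ^ m ≡ 1# → # (fibre y) ≡ e
      #fibre y e₁ = trans (sym (unit (# (fibre y)))) (trans (sum-mono-equality fibre-sum≤
          (ℕ.≤-trans (ℕ.≤-reflexive (trans #μ*e (trans (cong (ℕ._* e) #μ) (sym q≡)))) q≤fibres) y) (unit e))
        where
        unit : ∀ n → ⟦ μ y ⟧ ℕ.* n ≡ n
        unit n = trans (cong (λ b → ⟦ b ⟧ ℕ.* n) (dec-true (y ^ m ≟ 1#) e₁)) (ℕ.*-identityˡ n)

      abstract
        roots-of-unity : ∃ λ (w : Fin m → Fin (suc q)) →
          (∀ i → w i ^ m ≡ 1#) × (∀ i j → w i ≡ w j → i ≡ j) × (∀ y → y ^ m ≡ 1# → ∃ λ i → w i ≡ y)
        roots-of-unity with enumerate μ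
        ... | w , p , inj , onto = subst (λ n → ∃ λ (w : Fin n → Fin (suc q)) →
            (∀ i → w i ^ m ≡ 1#) × (∀ i j → w i ≡ w j → i ≡ j) × (∀ y → y ^ m ≡ 1# → ∃ λ i → w i ≡ y)) #μ
          (w , (λ i → does-true (w i ^ m ≟ 1#) (p i)) , inj , λ y e → onto y (dec-true (y ^ m ≟ 1#) e))

      w : Fin m → Fin (suc q)
      w = proj₁ roots-of-unity

      w^m : ∀ i → w i ^ m ≡ 1#
      w^m = proj₁ (proj₂ roots-of-unity)

      w-injective : ∀ i j → w i ≡ w j → i ≡ j
      w-injective = proj₁ (proj₂ (proj₂ roots-of-unity))

      w-onto : ∀ y → y ^ m ≡ 1# → ∃ λ i → w i ≡ y
      w-onto = proj₂ (proj₂ (proj₂ roots-of-unity))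

      w≢0 : ∀ i → w i ≢ 0#
      w≢0 i e = 1≢0 (trans (sym (w^m i)) (trans (cong (_^ m) e) (0^ m)))

      ρ : Fin m → Fin (suc q) → Fin (suc q) → Bool
      ρ i b a = does ((a - b) ^ e ≟ w i)

      degree : ∀ i a → sum (λ b → ⟦ ρ i b a ⟧) ≡ e
      degree i a = trans (sym (sum-permute (λ x → ⟦ fibre (w i) x ⟧)
        (permutation (λ b → a - b) (λ b → a - b) (x-[x-y]≡y a) (x-[x-y]≡y a)))) (#fibre (w i) (w^m i))

      -- If a - b and a′ - b lie in the same class, then their quotient
      -- 1 + (a′ - a) / (a - b) is an e-th root of unity, and it determines b.
      codegree : ∀ a a′ → a ≢ a′ → sum (λ i → sum (λ b → ⟦ ρ i b a ⟧ ℕ.* ⟦ ρ i b a′ ⟧)) ℕ.≤ e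
      codegree a a′ a≢a′ = begin
        sum (λ i → sum (λ b → ⟦ ρ i b a ⟧ ℕ.* ⟦ ρ i b a′ ⟧))    ≡⟨ sum-cong-≗ (λ i → sum-cong-≗ (λ b → sym (⟦∧⟧ (ρ i b a) (ρ i b a′)))) ⟩
        sum (λ i → sum (λ b → ⟦ ρ i b a ∧ ρ i b a′ ⟧))          ≡⟨ ∑-comm (λ i b → ⟦ ρ i b a ∧ ρ i b a′ ⟧) ⟩
        sum (λ b → # (λ i → ρ i b a ∧ ρ i b a′))                ≤⟨ sum-mono row ⟩
        # common                                                ≤⟨ #-injection common (fibre 1#) quot maps injective ⟩
        # (fibre 1#)                                            ≤⟨ #power-fibre e 1# ⟩
        e                                                       ∎
        where
        open ℕ.≤-Reasoning
        Common : Fin (suc q) → Fin m → Set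
        Common b i = (a - b) ^ e ≡ w i × (a′ - b) ^ e ≡ w i
        common? : ∀ b → Dec (∃ (Common b))
        common? b = Fin.any? (λ i → ((a - b) ^ e ≟ w i) ×-dec ((a′ - b) ^ e ≟ w i))
        common : Fin (suc q) → Bool
        common b = does (common? b)
        ∧-common : ∀ b i → ρ i b a ∧ ρ i b a′ ≡ true → Common b i
        ∧-common b i = does-true (((a - b) ^ e ≟ w i) ×-dec ((a′ - b) ^ e ≟ w i))
        row : ∀ b → # (λ i → ρ i b a ∧ ρ i b a′) ℕ.≤ ⟦ common b ⟧
        row b = go (common? b)
          where
          go : (d : Dec (∃ (Common b))) → # (λ i → ρ i b a ∧ ρ i b a′) ℕ.≤ ⟦ does d ⟧
          go (yes _) = #≤1 _ λ i j x y → w-injective i j (trans (sym (proj₁ (∧-common b i x))) (proj₁ (∧-common b j y)))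
          go (no none) = ℕ.≤-reflexive (trans (sum-cong-≗ zeros) (trans (sum-const m 0) (ℕ.*-zeroʳ m)))
            where
            zeros : ∀ i → ⟦ ρ i b a ∧ ρ i b a′ ⟧ ≡ 0
            zeros i with ρ i b a ∧ ρ i b a′ in eq
            ... | false = refl
            ... | true = ⊥-elim (none (i , ∧-common b i eq))
        d : Fin (suc q)
        d = a′ - a
        d≢0 : d ≢ 0#
        d≢0 h = a≢a′ (sym (x-y≡0⇒x≡y a′ a h))
        quot : Fin (suc q) → Fin (suc q)
        quot b = 1# + d * (a - b) ⁻¹
        common⇒≢0 : ∀ b → common b ≡ true → a - b ≢ 0#
        common⇒≢0 b h e₀ with does-true (common? b) h
        ... | i , p , _ = w≢0 i (trans (sym p) (trans (cong (_^ e) e₀) (0^ e)))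
        quot-* : ∀ b → a - b ≢ 0# → (a - b) * quot b ≡ a′ - b
        quot-* b u≢0 = trans (distribˡ u 1# _) (trans (cong₂ _+_ (*-identityʳ u)
            (trans (cong (u *_) (*-comm d (u ⁻¹))) (trans (sym (*-assoc u (u ⁻¹) d)) (trans (cong (_* d) (*-inverseʳ u u≢0)) (*-identityˡ d)))))
          (trans (+-comm u d) (trans (sym (+-assoc d a (- b))) (cong (_- b) ([x-y]+y≡x a′ a)))))
          where u = a - b
        maps : ∀ b → common b ≡ true → fibre 1# (quot b) ≡ true
        maps b h with does-true (common? b) h
        ... | i , p , p′ = dec-true (quot b ^ e ≟ 1#) (*-cancelˡ ((a - b) ^ e) (^-nonzero e u≢0)
            (trans (sym (^-distrib-* (a - b) (quot b) e)) (trans (cong (_^ e) (quot-* b u≢0))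
              (trans p′ (trans (sym p) (sym (*-identityʳ _)))))))
          where u≢0 = common⇒≢0 b h
        injective : ∀ b b′ → common b ≡ true → common b′ ≡ true → quot b ≡ quot b′ → b ≡ b′
        injective b b′ h h′ eq = trans (sym (x-[x-y]≡y a b)) (trans (cong (λ z → a - z) u≡u′) (x-[x-y]≡y a b′))
          where
          u = a - b
          u′ = a - b′
          inv≡ : u ⁻¹ ≡ u′ ⁻¹
          inv≡ = *-cancelˡ d d≢0 (+-cancelˡ 1# eq)
          u≡u′ : u ≡ u′
          u≡u′ = *-cancelˡ (u ⁻¹) (λ z → 1≢0 (trans (sym (*-inverseˡ u (common⇒≢0 b h))) (trans (cong (_* u) z) (zeroˡ u))))
            (trans (*-inverseˡ u (common⇒≢0 b h)) (trans (sym (*-inverseˡ u′ (common⇒≢0 b′ h′))) (cong (_* u′) (sym inv≡))))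

      differences-in-classes : ∀ k (c : Fin k → Fin k → Fin m) → threshold m k 1 ℕ.≤ suc q →
        ∃ λ (b : Fin k → Fin (suc q)) → ∀ i j → i Fin.< j → (b j - b i) ^ e ≡ w (c i j)
      differences-in-classes k c big = proj₁ chosen , λ i j i<j → does-true (_ ≟ w (c i j)) (proj₂ (proj₂ chosen) i j i<j)
        where
        dense : suc q ℕ.≤ # {suc q} (λ _ → true) ℕ.* 1
        dense = ℕ.≤-reflexive (sym (trans (ℕ.*-identityʳ _) (trans (sum-const (suc q) 1) (ℕ.*-identityʳ (suc q)))))
        -- Every candidate set starts as the whole field, of density 1, whence the argument 1 of the
        -- threshold.
        chosen = SecondMoment.choose ρ (cong suc q≡) degree codegree k 1 (λ _ _ → true) c (λ _ → dense) big

-- The coordinate action of G and an invariant transversal of the differences.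

module Representatives where

  open FiniteFields
  open Cyclotomy
  open import Defs using (FiniteGroup)
  open import Data.Nat as ℕ using (ℕ; zero; suc; NonZero)
  import Data.Nat.Properties as ℕ
  open import Data.Nat.Divisibility using (_∣_; divides)
  open import Data.Nat.DivMod using (_%_; _/_; m≡m%n+[m/n]*n; m%n<n)
  open import Data.Fin as Fin using (Fin; zero; suc; toℕ)
  import Data.Fin.Properties as Fin
  open import Data.Fin.Permutation using (permutation)
  open import Data.Vec using (Vec; []; _∷_; lookup; tabulate; map; zipWith; replicate)
  open import Data.Vec.Properties using (tabulate∘lookup; lookup∘tabulate; tabulate-cong; lookup-map; lookup-zipWith; lookup-replicate; ≡-dec)
  open import Data.Product using (∃; ∃₂; _×_; _,_; proj₁; proj₂)
  open import Data.Sum using (_⊎_; inj₁; inj₂)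
  open import Data.Empty using (⊥-elim)
  open import Function using (_∘_)
  open import Level using (0ℓ)
  open import Relation.Nullary using (¬_; Dec; yes; no; ¬?)
  open import Relation.Nullary.Decidable using (_×-dec_)
  open import Relation.Binary.PropositionalEquality
  open import Relation.Binary.Definitions using (tri<; tri≈; tri>)
  open import Algebra.Bundles using (Group)
  import Algebra.Properties.Group as GroupProperties

  argmin : ∀ {m} → .{{NonZero m}} → (f : Fin m → ℕ) → ∃ λ i → ∀ j → f i ℕ.≤ f j
  argmin {suc zero} f = zero , λ { zero → ℕ.≤-refl }
  argmin {suc (suc m)} f with argmin (f ∘ suc)
  ... | i , h with ℕ.≤-total (f zero) (f (suc i))
  ...   | inj₁ le = zero , λ { zero → ℕ.≤-refl ; (suc j) → ℕ.≤-trans le (h j) }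
  ...   | inj₂ ge = suc i , λ { zero → ge ; (suc j) → h j }

  lookup-ext : ∀ {A : Set} {n} {x y : Vec A n} → (∀ i → lookup x i ≡ lookup y i) → x ≡ y
  lookup-ext {x = x} {y} h = trans (sym (tabulate∘lookup x)) (trans (tabulate-cong h) (tabulate∘lookup y))

  module Vectors {q : ℕ} (K : Field (suc q)) (n : ℕ) where

    open FieldTheory K

    V : Set
    V = Vec (Fin (suc q)) n

    𝟎 : V
    𝟎 = replicate n 0#

    infixr 7 _∙_
    infixl 6 _⊞_
    _∙_ : ∀ {n} → Fin (suc q) → Vec (Fin (suc q)) n → Vec (Fin (suc q)) n
    c ∙ x = map (c *_) x

    _⊞_ : V → V → V
    x ⊞ y = zipWith _+_ x y

    neg : V → V
    neg x = (- 1#) ∙ x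

    lookup-∙ : ∀ c (x : V) i → lookup (c ∙ x) i ≡ c * lookup x i
    lookup-∙ c x i = lookup-map i (c *_) x

    lookup-⊞ : ∀ x y i → lookup (x ⊞ y) i ≡ lookup x i + lookup y i
    lookup-⊞ x y i = lookup-zipWith _+_ i x y

    lookup-𝟎 : ∀ i → lookup 𝟎 i ≡ 0#
    lookup-𝟎 i = lookup-replicate i 0#

    ∙-assoc : ∀ c d x → c ∙ d ∙ x ≡ (c * d) ∙ x
    ∙-assoc c d x = lookup-ext λ i → trans (lookup-∙ c (d ∙ x) i) (trans (cong (c *_) (lookup-∙ d x i))
      (trans (sym (*-assoc c d _)) (sym (lookup-∙ (c * d) x i))))

    ∙-identity : ∀ x → 1# ∙ x ≡ x
    ∙-identity x = lookup-ext λ i → trans (lookup-∙ 1# x i) (*-identityˡ _)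

    ∙-inverse : ∀ c x → c ≢ 0# → c ∙ c ⁻¹ ∙ x ≡ x
    ∙-inverse c x c≢0 = trans (∙-assoc c (c ⁻¹) x) (trans (cong (_∙ x) (*-inverseʳ c c≢0)) (∙-identity x))

    ∙-cancel : ∀ c {x y} → c ≢ 0# → c ∙ x ≡ c ∙ y → x ≡ y
    ∙-cancel c {x} {y} c≢0 e = lookup-ext λ i → *-cancelˡ c c≢0
      (trans (sym (lookup-∙ c x i)) (trans (cong (λ z → lookup z i) e) (lookup-∙ c y i)))

    ∙-𝟎 : ∀ c → c ∙ 𝟎 ≡ 𝟎
    ∙-𝟎 c = lookup-ext λ i → trans (lookup-∙ c 𝟎 i) (trans (cong (c *_) (lookup-𝟎 i)) (trans (zeroʳ c) (sym (lookup-𝟎 i))))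

    0∙ : ∀ x → 0# ∙ x ≡ 𝟎
    0∙ x = lookup-ext λ i → trans (lookup-∙ 0# x i) (trans (zeroˡ _) (sym (lookup-𝟎 i)))

    ∙-nonzero : ∀ {c x} → c ≢ 0# → x ≢ 𝟎 → c ∙ x ≢ 𝟎
    ∙-nonzero {c} c≢0 x≢𝟎 e = x≢𝟎 (∙-cancel c c≢0 (trans e (sym (∙-𝟎 c))))

    ∙-distribʳ : ∀ c d x → (c + d) ∙ x ≡ c ∙ x ⊞ d ∙ x
    ∙-distribʳ c d x = lookup-ext λ i → trans (lookup-∙ (c + d) x i) (trans (distribʳ _ c d)
      (sym (trans (lookup-⊞ (c ∙ x) (d ∙ x) i) (cong₂ _+_ (lookup-∙ c x i) (lookup-∙ d x i)))))

    ⊞-comm : ∀ x y → x ⊞ y ≡ y ⊞ x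
    ⊞-comm x y = lookup-ext λ i → trans (lookup-⊞ x y i) (trans (+-comm _ _) (sym (lookup-⊞ y x i)))

    ⊞-assoc : ∀ x y z → (x ⊞ y) ⊞ z ≡ x ⊞ (y ⊞ z)
    ⊞-assoc x y z = lookup-ext λ i → trans (lookup-⊞ (x ⊞ y) z i) (trans (cong (_+ lookup z i) (lookup-⊞ x y i))
      (trans (+-assoc _ _ _) (sym (trans (lookup-⊞ x (y ⊞ z) i) (cong (lookup x i +_) (lookup-⊞ y z i))))))

    ⊞-identity : ∀ x → 𝟎 ⊞ x ≡ x
    ⊞-identity x = lookup-ext λ i → trans (lookup-⊞ 𝟎 x i) (trans (cong (_+ lookup x i) (lookup-𝟎 i)) (+-identityˡ _))

    ⊞-neg : ∀ x → x ⊞ neg x ≡ 𝟎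
    ⊞-neg x = trans (cong (_⊞ neg x) (sym (∙-identity x))) (trans (sym (∙-distribʳ 1# (- 1#) x))
      (trans (cong (_∙ x) (-‿inverseʳ 1#)) (0∙ x)))

    _≟ᵥ_ : (x y : V) → Dec (x ≡ y)
    _≟ᵥ_ = ≡-dec _≟_

    -- The value `1#` for a vector without nonzero coordinate keeps `lead`, and with it `ψ`, nonzero
    -- everywhere.
    lead : ∀ {n} → Vec (Fin (suc q)) n → Fin (suc q)
    lead [] = 1#
    lead (a ∷ as) with a ≟ 0#
    ... | yes _ = lead as
    ... | no _ = a

    lead≢0 : ∀ {n} (x : Vec (Fin (suc q)) n) → lead x ≢ 0#
    lead≢0 [] = 1≢0
    lead≢0 (a ∷ as) with a ≟ 0#
    ... | yes _ = lead≢0 as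
    ... | no a≢0 = a≢0

    lead-∙ : ∀ {n} c (x : Vec (Fin (suc q)) n) → c ≢ 0# → x ≢ replicate n 0# → lead (c ∙ x) ≡ c * lead x
    lead-∙ c [] c≢0 x≢𝟎 = ⊥-elim (x≢𝟎 refl)
    lead-∙ c (a ∷ as) c≢0 x≢𝟎 with a ≟ 0# | c * a ≟ 0#
    ... | yes refl | yes _ = lead-∙ c as c≢0 (λ e → x≢𝟎 (cong (0# ∷_) e))
    ... | yes refl | no ne = ⊥-elim (ne (zeroʳ c))
    ... | no a≢0 | yes e = ⊥-elim (*-nonzero c≢0 a≢0 e)
    ... | no _ | no _ = refl

  module Action {q : ℕ} (K : Field (suc q)) (G : FiniteGroup) where

    open FiniteGroup G public using (_·_; inv) renaming (order to n; e to ε)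
    open FieldTheory K
    open Vectors K n public

    group : Group 0ℓ 0ℓ
    group = record { Carrier = Fin n ; _≈_ = _≡_ ; _∙_ = _·_ ; ε = ε ; _⁻¹ = inv ; isGroup = record
      { isMonoid = record { isSemigroup = record { isMagma = record { isEquivalence = isEquivalence ; ∙-cong = cong₂ _·_ }
                                                 ; assoc = FiniteGroup.assoc G }
                          ; identity = FiniteGroup.idˡ G , FiniteGroup.idʳ G }
      ; inverse = FiniteGroup.invˡ G , FiniteGroup.invʳ G ; ⁻¹-cong = cong inv } }

    open GroupProperties group public using (⁻¹-anti-homo-∙; ε⁻¹≈ε; ⁻¹-involutive)

    -- This is the left regular representation on functions from G to the field; the inverse makes
    -- it a left action.
    act : Fin n → V → V
    act h x = tabulate λ i → lookup x (inv h · i)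

    lookup-act : ∀ h x i → lookup (act h x) i ≡ lookup x (inv h · i)
    lookup-act h x i = lookup∘tabulate _ i

    act-act : ∀ h g x → act h (act g x) ≡ act (h · g) x
    act-act h g x = lookup-ext λ i → trans (lookup-act h (act g x) i) (trans (lookup-act g x (inv h · i))
      (trans (cong (lookup x) (trans (sym (FiniteGroup.assoc G (inv g) (inv h) i)) (cong (_· i) (sym (⁻¹-anti-homo-∙ h g)))))
        (sym (lookup-act (h · g) x i))))

    act-ε : ∀ x → act ε x ≡ x
    act-ε x = lookup-ext λ i → trans (lookup-act ε x i) (cong (lookup x) (trans (cong (_· i) ε⁻¹≈ε) (FiniteGroup.idˡ G i)))

    act-inv : ∀ h x → act (inv h) (act h x) ≡ x
    act-inv h x = trans (act-act (inv h) h x) (trans (cong (λ g → act g x) (FiniteGroup.invˡ G h)) (act-ε x))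

    act-inv′ : ∀ h x → act h (act (inv h) x) ≡ x
    act-inv′ h x = trans (act-act h (inv h) x) (trans (cong (λ g → act g x) (FiniteGroup.invʳ G h)) (act-ε x))

    act-∙ : ∀ h c x → act h (c ∙ x) ≡ c ∙ act h x
    act-∙ h c x = lookup-ext λ i → trans (lookup-act h (c ∙ x) i) (trans (lookup-∙ c x (inv h · i))
      (sym (trans (lookup-∙ c (act h x) i) (cong (c *_) (lookup-act h x i)))))

    act-⊞ : ∀ h x y → act h (x ⊞ y) ≡ act h x ⊞ act h y
    act-⊞ h x y = lookup-ext λ i → trans (lookup-act h (x ⊞ y) i) (trans (lookup-⊞ x y (inv h · i))
      (sym (trans (lookup-⊞ (act h x) (act h y) i) (cong₂ _+_ (lookup-act h x i) (lookup-act h y i)))))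

    act-𝟎 : ∀ h → act h 𝟎 ≡ 𝟎
    act-𝟎 h = lookup-ext λ i → trans (lookup-act h 𝟎 i) (trans (lookup-𝟎 _) (sym (lookup-𝟎 i)))

    act-nonzero : ∀ h {x} → x ≢ 𝟎 → act h x ≢ 𝟎
    act-nonzero h {x} x≢𝟎 e = x≢𝟎 (trans (sym (act-inv h x)) (trans (cong (act (inv h)) e) (act-𝟎 (inv h))))

    -- The indicator of ε has a regular orbit.
    act-faithful : ∀ g h → (∀ x → act g x ≡ act h x) → g ≡ h
    act-faithful g h same = trans (sym (⁻¹-involutive g)) (sym (trans (sym (FiniteGroup.idˡ G h)) (trans
        (cong (_· h) (sym (FiniteGroup.invˡ G (inv g)))) (trans (FiniteGroup.assoc G (inv (inv g)) (inv g) h)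
        (trans (cong (inv (inv g) ·_) inv·≡ε) (FiniteGroup.idʳ G _))))))
      where
      one : Fin n → Fin (suc q)
      one i with i Fin.≟ ε
      ... | yes _ = 1#
      ... | no _ = 0#
      one-ε : one ε ≡ 1#
      one-ε with ε Fin.≟ ε
      ... | yes _ = refl
      ... | no ne = ⊥-elim (ne refl)
      one≡1 : ∀ i → one i ≡ 1# → i ≡ ε
      one≡1 i h with i Fin.≟ ε
      ... | yes e = e
      ... | no _ = ⊥-elim (1≢0 (sym h))
      δ : V
      δ = tabulate one
      inv·≡ε : inv g · h ≡ ε
      inv·≡ε = one≡1 _ (trans (sym (lookup∘tabulate one _)) (trans (sym (lookup-act g δ h)) (trans (cong (λ z → lookup z h) (same δ))
        (trans (lookup-act h δ h) (trans (cong (lookup δ) (FiniteGroup.invˡ G h)) (trans (lookup∘tabulate one ε) one-ε))))))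

    ψ : V → Fin (suc q)
    ψ x = ∏ (λ h → lead (act h x))

    ψ≢0 : ∀ x → ψ x ≢ 0#
    ψ≢0 x = ∏-nonzero _ (λ h → lead≢0 (act h x))

    ψ-∙ : ∀ c x → c ≢ 0# → x ≢ 𝟎 → ψ (c ∙ x) ≡ c ^ n * ψ x
    ψ-∙ c x c≢0 x≢𝟎 = trans (∏.sum-cong-≗ (λ h → trans (cong lead (act-∙ h c x)) (lead-∙ c (act h x) c≢0 (act-nonzero h x≢𝟎))))
      (trans (∏.∑-distrib-+ (λ _ → c) (λ h → lead (act h x))) (cong (_* ψ x) (∏-const n c)))

    -- The factor at `h` for `act g x` is the factor at `h · g` for `x`, so the action only permutes
    -- the factors.
    ψ-act : ∀ g x → ψ (act g x) ≡ ψ x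
    ψ-act g x = trans (∏.sum-cong-≗ (λ h → cong lead (act-act h g x)))
      (sym (∏.sum-permute (λ h → lead (act h x)) (permutation (_· g) (_· inv g)
        (λ h → cancel h (FiniteGroup.invˡ G g)) (λ h → cancel h (FiniteGroup.invʳ G g)))))
      where
      cancel : ∀ h {a b} → a · b ≡ ε → (h · a) · b ≡ h
      cancel h e = trans (FiniteGroup.assoc G h _ _) (trans (cong (h ·_) e) (FiniteGroup.idʳ G h))

  odd : ∀ n → ¬ (2 ∣ n) → ∃ λ t → n ≡ suc (2 ℕ.* t)
  odd n ¬2∣n with n % 2 | n / 2 | m≡m%n+[m/n]*n n 2 | m%n<n n 2
  ... | 0 | t | eq | _ = ⊥-elim (¬2∣n (divides t eq))
  ... | 1 | t | eq | _ = t , trans eq (cong suc (ℕ.*-comm t 2))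
  ... | suc (suc r) | _ | _ | ℕ.s≤s (ℕ.s≤s ())

  module Transversal {q : ℕ} (K : Field (suc q)) (G : FiniteGroup) (odd-order : ¬ (2 ∣ FiniteGroup.order G)) where

    open FieldTheory K
    open Action K G public

    -- The exponent `s` makes `ψ ^ s` scale by `c ^ e`, hence by the class of `c`. The witness `t`
    -- makes `e` even, so a difference and its negative share a class.
    module Exponents (2≢0 : 1# + 1# ≢ 0#) (m e s t : ℕ) .{{m≢0 : NonZero m}} .{{e≢0 : NonZero e}}
      (q≡ : q ≡ m ℕ.* e) (e≡ns : n ℕ.* s ≡ e) (e≡2t : e ≡ 2 ℕ.* t) where

      open Classes m e q≡

      module Differences {k : ℕ} (b : Fin k → Fin (suc q)) (class : Fin k → Fin k → Fin m)
        (difference : ∀ i j → i ≢ j → (b i - b j) ^ e ≡ w (class i j))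
        (class-unique : ∀ i j i′ j′ → i ≢ j → i′ ≢ j′ → class i j ≡ class i′ j′ → (i ≡ i′ × j ≡ j′) ⊎ (i ≡ j′ × j ≡ i′))
        (class-onto : ∀ c → ∃₂ λ i j → i ≢ j × class i j ≡ c) where

        -1^e : (- 1#) ^ e ≡ 1#
        -1^e = trans (cong ((- 1#) ^_) e≡2t) (-1^even t)

        -1^n : (- 1#) ^ n ≡ - 1#
        -1^n with odd n odd-order
        ... | r , eq = trans (cong ((- 1#) ^_) eq) (trans (cong (- 1# *_) (-1^even r)) (*-identityʳ (- 1#)))

        ψ-neg : ∀ x → x ≢ 𝟎 → ψ (neg x) ≡ - ψ x
        ψ-neg x x≢𝟎 = trans (ψ-∙ (- 1#) x -1≢0 x≢𝟎) (trans (cong (_* ψ x) -1^n)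
          (trans (sym (-‿distribˡ-* 1# (ψ x))) (cong -_ (*-identityˡ (ψ x)))))

        x≢-x : ∀ x → x ≢ 0# → x ≢ - x
        x≢-x x x≢0 eq = *-nonzero 2≢0 x≢0 (trans (distribʳ x 1# 1#) (trans (cong₂ _+_ (*-identityˡ x) (trans (*-identityˡ x) eq)) (-‿inverseʳ x)))

        χ : V → Fin (suc q)
        χ x = ψ x ^ s

        χ≢0 : ∀ x → χ x ≢ 0#
        χ≢0 x = ^-nonzero s (ψ≢0 x)

        χ-∙ : ∀ c x → c ≢ 0# → x ≢ 𝟎 → χ (c ∙ x) ≡ c ^ e * χ x
        χ-∙ c x c≢0 x≢𝟎 = trans (cong (_^ s) (ψ-∙ c x c≢0 x≢𝟎)) (trans (^-distrib-* (c ^ n) (ψ x) s)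
          (cong (_* χ x) (trans (^-assocʳ c n s) (cong (c ^_) e≡ns))))

        -- The order of `Fin` serves only to pick one element from each coset of the `m`-th roots of
        -- unity.
        Minimal : Fin (suc q) → Set
        Minimal z = ∀ i → toℕ z ℕ.≤ toℕ (w i * z)

        -- Passing from y to y / d multiplies χ by d ^ - e. Hence minimality of χ selects
        -- the class of d, and positivity, as ψ is odd, selects between d and - d.
        record T (x : V) : Set where
          constructor transversal
          field
            nonzero  : x ≢ 𝟎
            minimal  : Minimal (χ x)
            positive : toℕ (ψ x) ℕ.< toℕ (- ψ x)
        open T public

        T? : ∀ x → Dec (T x)
        T? x with ¬? (x ≟ᵥ 𝟎) ×-dec (Fin.all? (λ i → toℕ (χ x) ℕ.≤? toℕ (w i * χ x)) ×-dec (toℕ (ψ x) ℕ.<? toℕ (- ψ x)))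
        ... | yes (a , c , d) = yes (transversal a c d)
        ... | no h = no λ t → h (nonzero t , minimal t , positive t)

        T-act : ∀ g x → T x → T (act g x)
        T-act g x (transversal a c d) = transversal (act-nonzero g a)
          (subst Minimal (cong (_^ s) (sym (ψ-act g x))) c) (subst (λ z → toℕ z ℕ.< toℕ (- z)) (sym (ψ-act g x)) d)

        differ : ∀ i j → i ≢ j → b i - b j ≢ 0#
        differ i j i≢j e₀ = w≢0 (class i j) (trans (sym (difference i j i≢j)) (trans (cong (_^ e) e₀) (0^ e)))

        w-product : ∀ i j → ∃ λ l → w l ≡ w i * w j
        w-product i j = w-onto (w i * w j) (trans (^-distrib-* (w i) (w j) m) (trans (cong₂ _*_ (w^m i) (w^m j)) (*-identityˡ 1#)))

        w-inverse : ∀ i → ∃ λ l → w l * w i ≡ 1#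
        w-inverse i with w-onto (w i ⁻¹) (trans (sym (*-identityʳ _)) (trans (cong (w i ⁻¹ ^ m *_) (sym (w^m i)))
            (trans (sym (^-distrib-* (w i ⁻¹) (w i) m)) (trans (cong (_^ m) (*-inverseˡ (w i) (w≢0 i))) (1^ m)))))
        ... | l , eq = l , trans (cong (_* w i) eq) (*-inverseˡ (w i) (w≢0 i))

        transpose : ∀ i l {x y} → w l * w i ≡ 1# → y ≡ w i * x → w l * y ≡ x
        transpose i l {x} inv≡ refl = trans (sym (*-assoc (w l) (w i) x)) (trans (cong (_* x) inv≡) (*-identityˡ x))

        minimal-unique : ∀ x y i → Minimal x → Minimal y → y ≡ w i * x → x ≡ y
        minimal-unique x y i mx my eq with w-inverse i
        ... | l , inv≡ = Fin.toℕ-injective (ℕ.≤-antisym (subst (λ z → toℕ x ℕ.≤ toℕ z) (sym eq) (mx i))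
            (subst (λ z → toℕ y ℕ.≤ toℕ z) (transpose i l inv≡ eq) (my l)))

        χ-difference : ∀ i j x → i ≢ j → x ≢ 𝟎 → χ ((b i - b j) ∙ x) ≡ w (class i j) * χ x
        χ-difference i j x i≢j x≢𝟎 = trans (χ-∙ (b i - b j) x (differ i j i≢j) x≢𝟎) (cong (_* χ x) (difference i j i≢j))

        χ-neg : ∀ x → x ≢ 𝟎 → χ (neg x) ≡ χ x
        χ-neg x x≢𝟎 = trans (χ-∙ (- 1#) x -1≢0 x≢𝟎) (trans (cong (_* χ x) -1^e) (*-identityˡ (χ x)))

        -- Let `w i₀ * χ y` be the least element of the coset of `χ y`. Dividing `y` by a difference
        -- whose class is the inverse of `w i₀` gives an `x` with exactly this `χ`. If `ψ x` has the
        -- wrong sign, replace `x` by its negative and exchange `i` and `j`.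
        represent : ∀ y → y ≢ 𝟎 → ∃₂ λ i j → ∃ λ x → i ≢ j × T x × y ≡ (b i - b j) ∙ x
        represent y y≢𝟎 = go (class-onto (proj₁ (w-inverse i₀)))
          where
          i₀ = proj₁ (argmin (λ i → toℕ (w i * χ y)))
          least = proj₂ (argmin (λ i → toℕ (w i * χ y)))
          go : (∃₂ λ i j → i ≢ j × class i j ≡ proj₁ (w-inverse i₀)) → ∃₂ λ i j → ∃ λ x → i ≢ j × T x × y ≡ (b i - b j) ∙ x
          go (i , j , i≢j , cl) = orient (ℕ.<-cmp (toℕ (ψ x)) (toℕ (- ψ x)))
            where
            d = b i - b j
            d≢0 = differ i j i≢j
            x = d ⁻¹ ∙ y
            dx≡y : d ∙ x ≡ y
            dx≡y = ∙-inverse d y d≢0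
            x≢𝟎 : x ≢ 𝟎
            x≢𝟎 e₀ = y≢𝟎 (trans (sym dx≡y) (trans (cong (d ∙_) e₀) (∙-𝟎 d)))
            χy≡ : χ y ≡ w (class i j) * χ x
            χy≡ = trans (cong χ (sym dx≡y)) (χ-difference i j x i≢j x≢𝟎)
            χx≡ : w i₀ * χ y ≡ χ x
            χx≡ = transpose (class i j) i₀ (trans (*-comm (w i₀) _) (trans (cong (λ c → w c * w i₀) cl) (proj₂ (w-inverse i₀)))) χy≡
            minx : Minimal (χ x)
            minx l with w-product l i₀
            ... | l′ , eq = subst₂ (λ z z′ → toℕ z ℕ.≤ toℕ z′) χx≡
              (trans (cong (_* χ y) eq) (trans (*-assoc (w l) (w i₀) (χ y)) (cong (w l *_) χx≡))) (least l′)
            orient : _ → ∃₂ λ i j → ∃ λ x → i ≢ j × T x × y ≡ (b i - b j) ∙ x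
            orient (tri< lt _ _) = i , j , x , i≢j , transversal x≢𝟎 minx lt , sym dx≡y
            orient (tri≈ _ eq _) = ⊥-elim (x≢-x (ψ x) (ψ≢0 x) (Fin.toℕ-injective eq))
            orient (tri> _ _ gt) = j , i , neg x , (λ e → i≢j (sym e)) ,
              transversal (∙-nonzero -1≢0 x≢𝟎) (subst Minimal (sym (χ-neg x x≢𝟎)) minx)
                (subst₂ (λ z z′ → toℕ z ℕ.< toℕ z′) (sym (ψ-neg x x≢𝟎))
                  (sym (trans (cong -_ (ψ-neg x x≢𝟎)) (-‿involutive (ψ x)))) gt) ,
              sym (trans (∙-assoc (b j - b i) (- 1#) x) (trans (cong (_∙ x) (trans (*-comm (b j - b i) (- 1#)) (sym (neg-difference (b j) (b i))))) dx≡y))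

        -- The values of `χ` at `x` and `x′` are minimal in one coset, so they agree, and then so do
        -- the classes. Hence the index pairs agree up to order. In the reversed order `x′` would be
        -- `neg x`, and both could not be positive.
        represent-unique : ∀ i j i′ j′ x x′ → i ≢ j → i′ ≢ j′ → T x → T x′ →
          (b i - b j) ∙ x ≡ (b i′ - b j′) ∙ x′ → i ≡ i′ × j ≡ j′ × x ≡ x′
        represent-unique i j i′ j′ x x′ i≢j i′≢j′ tx tx′ eq = split (class-unique i j i′ j′ i≢j i′≢j′ same-class)
          where
          c = class i j
          c′ = class i′ j′
          χs : w c * χ x ≡ w c′ * χ x′
          χs = trans (sym (χ-difference i j x i≢j (nonzero tx))) (trans (cong χ eq) (χ-difference i′ j′ x′ i′≢j′ (nonzero tx′)))
          χ≡ : χ x ≡ χ x′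
          χ≡ with w-inverse c′
          ... | l , inv≡ with w-product l c
          ...   | r , eq′ = minimal-unique (χ x) (χ x′) r (minimal tx) (minimal tx′)
                    (trans (sym (transpose c′ l inv≡ χs)) (trans (sym (*-assoc (w l) (w c) (χ x))) (cong (_* χ x) (sym eq′))))
          same-class : c ≡ c′
          same-class = w-injective c c′ (*-cancelʳ (χ x) (χ≢0 x) (trans χs (cong (w c′ *_) (sym χ≡))))
          split : (i ≡ i′ × j ≡ j′) ⊎ (i ≡ j′ × j ≡ i′) → i ≡ i′ × j ≡ j′ × x ≡ x′
          split (inj₁ (refl , refl)) = refl , refl , ∙-cancel (b i - b j) (differ i j i≢j) eq
          split (inj₂ (refl , refl)) = ⊥-elim (ℕ.<-asym (positive tx)
              (subst₂ (λ z z′ → toℕ z ℕ.< toℕ z′) ψ′ (trans (cong -_ ψ′) (-‿involutive (ψ x))) (positive tx′)))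
            where
            x≡ : neg x ≡ x′
            x≡ = ∙-cancel (b j - b i) (differ j i (λ e → i≢j (sym e)))
              (trans (∙-assoc (b j - b i) (- 1#) x) (trans (cong (_∙ x) (trans (*-comm (b j - b i) (- 1#)) (sym (neg-difference (b j) (b i))))) eq))
            ψ′ : ψ x′ ≡ - ψ x
            ψ′ = trans (cong ψ (sym x≡)) (ψ-neg x (nonzero tx))

-- Designs from lists of blocks, and the development of the scaled base block.

module Designs where

  open FiniteFields
  open Counting
  open Cyclotomy
  open Representatives
  open import Defs
  open import Data.Nat as ℕ using (ℕ; zero; suc; NonZero)
  import Data.Nat.Properties as ℕ
  open import Data.Fin as Fin using (Fin; zero; suc; funToFin; finToFun; combine; remQuot)
  import Data.Fin.Properties as Fin
  open import Data.Fin.Subset using (Subset; _∈_; ∣_∣)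
  open import Data.Fin.Permutation using (Permutation′; permutation; _⟨$⟩ʳ_)
  open import Data.Vec using (Vec; []; _∷_; lookup; tabulate)
  open import Data.Vec.Properties using (lookup∘tabulate; tabulate-cong; ≡-dec; []=⇒lookup; lookup⇒[]=)
  open import Data.List as List using (List; []; _∷_; length; deduplicate; filter; allFin; cartesianProductWith)
  import Data.List.Membership.Propositional as List
  open import Data.List.Membership.Propositional.Properties
    using (∈-lookup; ∈-filter⁺; ∈-filter⁻; ∈-allFin; ∈-cartesianProductWith⁺; ∈-cartesianProductWith⁻; ∈-deduplicate⁺; ∈-deduplicate⁻)
  open import Data.List.Relation.Unary.Any using (index)
  open import Data.List.Relation.Unary.Any.Properties using (lookup-index)
  import Data.List.Relation.Unary.All as All
  open import Data.List.Relation.Unary.Unique.Propositional using (Unique; []; _∷_)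
  open import Data.Bool using (Bool; true; false)
  import Data.Bool.Properties as Bool
  open import Data.Product using (Σ; ∃; ∃₂; _×_; _,_; proj₁; proj₂)
  open import Data.Sum using (_⊎_; inj₁; inj₂)
  open import Data.Empty using (⊥-elim)
  open import Function using (_∘_)
  open import Function.Bundles using (mk⇔)
  open import Relation.Nullary using (Dec; yes; no; does)
  open import Relation.Nullary.Decidable using (dec-true; does-⇔)
  open import Relation.Binary.PropositionalEquality

  ∣tabulate∣ : ∀ {n} (A : Fin n → Bool) → ∣ tabulate A ∣ ≡ # A
  ∣tabulate∣ {zero} A = refl
  ∣tabulate∣ {suc n} A with A zero
  ... | true = cong suc (∣tabulate∣ (A ∘ suc))
  ... | false = ∣tabulate∣ (A ∘ suc)

  lookup-injective : ∀ {A : Set} {xs : List A} → Unique xs → ∀ i j → List.lookup xs i ≡ List.lookup xs j → i ≡ j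
  lookup-injective (x∉ ∷ u) zero zero e = refl
  lookup-injective {xs = _ ∷ xs} (x∉ ∷ u) zero (suc j) e = ⊥-elim (All.lookup x∉ (∈-lookup {xs = xs} j) e)
  lookup-injective {xs = _ ∷ xs} (x∉ ∷ u) (suc i) zero e = ⊥-elim (All.lookup x∉ (∈-lookup {xs = xs} i) (sym e))
  lookup-injective (x∉ ∷ u) (suc i) (suc j) e = cong suc (lookup-injective u i j e)

  -- Blocks may be listed by their parameters with repetitions; deduplication then supplies
  -- `block-inj`.
  module DesignFromList {v k : ℕ} (blocks : List (Subset v)) (size : ∀ {B} → B List.∈ blocks → ∣ B ∣ ≡ k)
    (pair : ∀ x y → x ≢ y → ∃ λ B → B List.∈ blocks × x ∈ B × y ∈ B)
    (unique : ∀ {B B′ x y} → B List.∈ blocks → B′ List.∈ blocks → x ≢ y → x ∈ B → y ∈ B → x ∈ B′ → y ∈ B′ → B ≡ B′) where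

    open import Data.List.Relation.Unary.Unique.DecPropositional.Properties (≡-dec {n = v} Bool._≟_) using (deduplicate-!)

    distinct : List (Subset v)
    distinct = deduplicate (≡-dec Bool._≟_) blocks

    nth : Fin (length distinct) → Subset v
    nth = List.lookup distinct

    nth∈ : ∀ i → nth i List.∈ blocks
    nth∈ i = ∈-deduplicate⁻ (≡-dec Bool._≟_) blocks (∈-lookup {xs = distinct} i)

    ∈⇒nth : ∀ {B} → B List.∈ blocks → ∃ λ i → B ≡ nth i
    ∈⇒nth B∈ = index B∈′ , lookup-index B∈′
      where B∈′ = ∈-deduplicate⁺ (≡-dec Bool._≟_) B∈

    nth-injective : ∀ i j → nth i ≡ nth j → i ≡ j
    nth-injective = lookup-injective (deduplicate-! blocks)

    design : Design v k
    design = record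
      { b = length distinct
      ; block = nth
      ; block-size = λ i → size (nth∈ i)
      ; block-inj = nth-injective
      ; pair-unique = through }
      where
      through : ∀ x y → x ≢ y → Σ (Fin (length distinct)) λ i → (x ∈ nth i) × (y ∈ nth i) × (∀ j → x ∈ nth j → y ∈ nth j → j ≡ i)
      through x y x≢y with pair x y x≢y
      ... | B , B∈ , x∈ , y∈ with ∈⇒nth B∈
      ...   | i , refl = i , x∈ , y∈ , λ j x∈′ y∈′ → nth-injective j i (unique (nth∈ j) (nth∈ i) x≢y x∈′ y∈′ x∈ y∈)

    automorphism : ∀ σ → (∀ {B} → B List.∈ blocks → image σ B List.∈ blocks) →
      (∀ {B} → B List.∈ blocks → ∃ λ B′ → B′ List.∈ blocks × image σ B′ ≡ B) → IsAutomorphism design σ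
    automorphism σ into onto = (λ i → ∈⇒nth (into (nth∈ i))) , surjective
      where
      surjective : ∀ j → ∃ λ i → image σ (nth i) ≡ nth j
      surjective j with onto (nth∈ j)
      ... | B , B∈ , e with ∈⇒nth B∈
      ...   | i , refl = i , e

  -- class indexes the two-element subsets of Fin k; its values on the diagonal are junk.
  record PairIndexing (k m : ℕ) : Set where
    field
      class  : Fin k → Fin k → Fin m
      symmetric : ∀ i j → class i j ≡ class j i
      unique : ∀ i j i′ j′ → i ≢ j → i′ ≢ j′ → class i j ≡ class i′ j′ → (i ≡ i′ × j ≡ j′) ⊎ (i ≡ j′ × j ≡ i′)
      onto   : ∀ c → ∃₂ λ i j → i ≢ j × class i j ≡ c

  -- Unordered pairs are counted as increasing pairs among the codes in `Fin (k * k)`. The pair of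
  -- the two smallest elements, present as `k ≥ 2`, shows `m` nonzero and supplies the junk value on
  -- the diagonal.
  pair-indexing : ∀ k → 2 ℕ.≤ k → ∃ λ m → NonZero m × PairIndexing k m
  pair-indexing (suc zero) (ℕ.s≤s ())
  pair-indexing k@(suc (suc _)) _ = # increasing , Fin.nonZeroIndex default , record { class = class ; symmetric = symmetric ; unique = unique ; onto = onto }
    where
    pair : Fin (k ℕ.* k) → Fin k × Fin k
    pair = remQuot k
    increasing? : ∀ z → Dec (proj₁ (pair z) Fin.< proj₂ (pair z))
    increasing? z = proj₁ (pair z) Fin.<? proj₂ (pair z)
    increasing : Fin (k ℕ.* k) → Bool
    increasing z = does (increasing? z)
    e = enumerate increasing
    w = proj₁ e
    w< = proj₁ (proj₂ e)
    w-injective = proj₁ (proj₂ (proj₂ e))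
    w-onto = proj₂ (proj₂ (proj₂ e))
    code< : ∀ {i j} → i Fin.< j → increasing (combine i j) ≡ true
    code< {i} {j} i<j = dec-true (increasing? (combine i j)) (subst (λ z → proj₁ z Fin.< proj₂ z) (sym (Fin.remQuot-combine i j)) i<j)
    index< : ∀ {i j} → i Fin.< j → Fin (# increasing)
    index< {i} {j} i<j = proj₁ (w-onto (combine i j) (code< i<j))
    w-index< : ∀ {i j} (i<j : i Fin.< j) → w (index< i<j) ≡ combine i j
    w-index< {i} {j} i<j = proj₂ (w-onto (combine i j) (code< i<j))
    default : Fin (# increasing)
    default = index< {zero} {suc zero} (ℕ.s≤s ℕ.z≤n)
    class : Fin k → Fin k → Fin (# increasing)
    class i j with i Fin.<? j | j Fin.<? i
    ... | yes i<j | _ = index< i<j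
    ... | no _ | yes j<i = index< j<i
    ... | no _ | no _ = default
    symmetric : ∀ i j → class i j ≡ class j i
    symmetric i j with i Fin.<? j | j Fin.<? i
    ... | yes i<j | yes j<i = ⊥-elim (ℕ.<-asym i<j j<i)
    ... | yes _ | no _ = refl
    ... | no _ | yes _ = refl
    ... | no _ | no _ = refl
    sorted : ∀ i j → i ≢ j → w (class i j) ≡ combine i j ⊎ w (class i j) ≡ combine j i
    sorted i j i≢j with i Fin.<? j | j Fin.<? i
    ... | yes i<j | _ = inj₁ (w-index< i<j)
    ... | no _ | yes j<i = inj₂ (w-index< j<i)
    ... | no i≮j | no j≮i = ⊥-elim (i≢j (Fin.toℕ-injective (ℕ.≤-antisym (ℕ.≮⇒≥ j≮i) (ℕ.≮⇒≥ i≮j))))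
    unique : ∀ i j i′ j′ → i ≢ j → i′ ≢ j′ → class i j ≡ class i′ j′ → (i ≡ i′ × j ≡ j′) ⊎ (i ≡ j′ × j ≡ i′)
    unique i j i′ j′ i≢j i′≢j′ eq with sorted i j i≢j | sorted i′ j′ i′≢j′
    ... | inj₁ a | inj₁ c = inj₁ (Fin.combine-injective i j i′ j′ (trans (sym a) (trans (cong w eq) c)))
    ... | inj₁ a | inj₂ c = inj₂ (Fin.combine-injective i j j′ i′ (trans (sym a) (trans (cong w eq) c)))
    ... | inj₂ a | inj₁ c with Fin.combine-injective j i i′ j′ (trans (sym a) (trans (cong w eq) c))
    ...   | x , y = inj₂ (y , x)
    unique i j i′ j′ i≢j i′≢j′ eq | inj₂ a | inj₂ c with Fin.combine-injective j i j′ i′ (trans (sym a) (trans (cong w eq) c))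
    ...   | x , y = inj₁ (y , x)
    onto : ∀ c → ∃₂ λ i j → i ≢ j × class i j ≡ c
    onto c = i , j , i≢j , w-injective (class i j) c (trans same (Fin.combine-remQuot {k} k (w c)))
      where
      i = proj₁ (pair (w c))
      j = proj₂ (pair (w c))
      i<j : i Fin.< j
      i<j = does-true (increasing? (w c)) (w< c)
      i≢j : i ≢ j
      i≢j i≡j = ℕ.<-irrefl (cong Fin.toℕ i≡j) i<j
      same : w (class i j) ≡ combine i j
      same with i Fin.<? j | j Fin.<? i
      ... | yes i<j | _ = w-index< i<j
      ... | no i≮j | _ = ⊥-elim (i≮j i<j)

  module Construction {q : ℕ} (K : Field (suc q)) (G : FiniteGroup) where

    open FieldTheory K
    open Action K G

    ⊞-cancelˡ : ∀ z {x y} → z ⊞ x ≡ z ⊞ y → x ≡ y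
    ⊞-cancelˡ z {x} {y} eq = lookup-ext λ i → +-cancelˡ (lookup z i)
      (trans (sym (lookup-⊞ z x i)) (trans (cong (λ u → lookup u i) eq) (lookup-⊞ z y i)))

    ⊞-neg-cancel : ∀ x y → x ⊞ (neg x ⊞ y) ≡ y
    ⊞-neg-cancel x y = trans (sym (⊞-assoc x (neg x) y)) (trans (cong (_⊞ y) (⊞-neg x)) (⊞-identity y))

    v : ℕ
    v = suc q ℕ.^ n

    encode : V → Fin v
    encode x = funToFin (lookup x)

    decode : Fin v → V
    decode z = tabulate (finToFun z)

    decode-encode : ∀ x → decode (encode x) ≡ x
    decode-encode x = lookup-ext λ i → trans (lookup∘tabulate _ i) (Fin.finToFun-funToFin (lookup x) i)

    funToFin-cong : ∀ {m} {f g : Fin m → Fin (suc q)} → (∀ i → f i ≡ g i) → funToFin f ≡ funToFin g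
    funToFin-cong {zero} h = refl
    funToFin-cong {suc m} h = cong₂ combine (h zero) (funToFin-cong (h ∘ suc))

    encode-decode : ∀ z → encode (decode z) ≡ z
    encode-decode z = trans (funToFin-cong {n} (λ i → lookup∘tabulate (finToFun z) i)) (Fin.funToFin-finToFin {n} z)

    encode-injective : ∀ x y → encode x ≡ encode y → x ≡ y
    encode-injective x y e = trans (sym (decode-encode x)) (trans (cong decode e) (decode-encode y))

    decode-injective : ∀ x y → decode x ≡ decode y → x ≡ y
    decode-injective x y e = trans (sym (encode-decode x)) (trans (cong encode e) (encode-decode y))

    module Translates {k : ℕ} (b : Fin k → Fin (suc q)) (T : V → Set) (T? : ∀ x → Dec (T x))
      (T-nonzero : ∀ {x} → T x → x ≢ 𝟎) (T-act : ∀ g x → T x → T (act g x))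
      (differ : ∀ i j → i ≢ j → b i - b j ≢ 0#)
      (represent : ∀ y → y ≢ 𝟎 → ∃₂ λ i j → ∃ λ x → i ≢ j × T x × y ≡ (b i - b j) ∙ x)
      (represent-unique : ∀ i j i′ j′ x x′ → i ≢ j → i′ ≢ j′ → T x → T x′ →
        (b i - b j) ∙ x ≡ (b i′ - b j′) ∙ x′ → i ≡ i′ × j ≡ j′ × x ≡ x′) where

      -- A difference vector carries the `j`-th point of a block to the `i`-th. With cancellation
      -- this reduces existence and uniqueness of blocks to `represent` and `represent-unique`.
      move : ∀ t i j x → (t ⊞ b j ∙ x) ⊞ (b i - b j) ∙ x ≡ t ⊞ b i ∙ x
      move t i j x = trans (⊞-assoc t (b j ∙ x) ((b i - b j) ∙ x)) (cong (t ⊞_)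
        (trans (sym (∙-distribʳ (b j) (b i - b j) x)) (cong (_∙ x) (trans (+-comm (b j) (b i - b j)) ([x-y]+y≡x (b i) (b j))))))

      point : V → V → Fin k → Fin v
      point t x i = encode (t ⊞ b i ∙ x)

      point? : ∀ t x z → Dec (∃ λ i → z ≡ point t x i)
      point? t x z = Fin.any? (λ i → z Fin.≟ point t x i)

      blockOf : V → V → Subset v
      blockOf t x = tabulate (λ z → does (point? t x z))

      ∈⇒point : ∀ {t x z} → z ∈ blockOf t x → ∃ λ i → z ≡ point t x i
      ∈⇒point {t} {x} {z} h = does-true (point? t x z) (trans (sym (lookup∘tabulate _ z)) ([]=⇒lookup h))

      point∈ : ∀ t x z i → z ≡ point t x i → z ∈ blockOf t x
      point∈ t x z i e = lookup⇒[]= z _ (trans (lookup∘tabulate _ z) (dec-true (point? t x z) (i , e)))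

      point-injective : ∀ t {x} → x ≢ 𝟎 → ∀ i j → point t x i ≡ point t x j → i ≡ j
      point-injective t {x} x≢𝟎 i j e with i Fin.≟ j
      ... | yes i≡j = i≡j
      ... | no i≢j = ⊥-elim (∙-nonzero (differ i j i≢j) x≢𝟎 (⊞-cancelˡ (t ⊞ b j ∙ x)
              (trans (move t i j x) (trans (encode-injective (t ⊞ b i ∙ x) (t ⊞ b j ∙ x) e) (sym (trans (⊞-comm (t ⊞ b j ∙ x) 𝟎) (⊞-identity (t ⊞ b j ∙ x))))))))

      ∣blockOf∣ : ∀ t {x} → x ≢ 𝟎 → ∣ blockOf t x ∣ ≡ k
      ∣blockOf∣ t {x} x≢𝟎 = trans (∣tabulate∣ member) (ℕ.≤-antisym #member≤k
          (ℕ.≤-trans (ℕ.≤-reflexive (sym (trans (sum-const k 1) (ℕ.*-identityʳ k))))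
            (#-injection {k} (λ _ → true) member (point t x) (λ i _ → dec-true (point? t x (point t x i)) (i , refl))
              (λ i j _ _ → point-injective t x≢𝟎 i j))))
        where
        member : Fin v → Bool
        member z = does (point? t x z)
        covered : ∀ z → ⟦ member z ⟧ ℕ.≤ sum (λ i → ⟦ does (z Fin.≟ point t x i) ⟧)
        covered z = go (point? t x z)
          where
          go : (d : Dec (∃ λ i → z ≡ point t x i)) → ⟦ does d ⟧ ℕ.≤ sum (λ i → ⟦ does (z Fin.≟ point t x i) ⟧)
          go (yes (i , e)) = #≥1 (λ i → does (z Fin.≟ point t x i)) i (dec-true (z Fin.≟ point t x i) e)
          go (no _) = ℕ.z≤n
        #member≤k : # member ℕ.≤ k
        #member≤k = begin
          # member                                                 ≤⟨ sum-mono covered ⟩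
          sum (λ z → sum (λ i → ⟦ does (z Fin.≟ point t x i) ⟧))   ≡⟨ ∑-comm (λ z i → ⟦ does (z Fin.≟ point t x i) ⟧) ⟩
          sum (λ i → sum (λ z → ⟦ does (z Fin.≟ point t x i) ⟧))   ≤⟨ sum-mono (λ i → #≤1 (λ z → does (z Fin.≟ point t x i)) (λ y z e f →
                                                                        trans (does-true (y Fin.≟ point t x i) e) (sym (does-true (z Fin.≟ point t x i) f)))) ⟩
          sum {k} (λ _ → 1)                                        ≡⟨ trans (sum-const k 1) (ℕ.*-identityʳ k) ⟩
          k                                                        ∎
          where open ℕ.≤-Reasoning

      blocks : List (Subset v)
      blocks = cartesianProductWith (λ t x → blockOf (decode t) (decode x)) (allFin v) (filter (T? ∘ decode) (allFin v))

      ∈blocks : ∀ {B} → B List.∈ blocks → ∃₂ λ t x → T x × B ≡ blockOf t x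
      ∈blocks B∈ with ∈-cartesianProductWith⁻ _ (allFin v) (filter (T? ∘ decode) (allFin v)) B∈
      ... | t , x , _ , x∈ , e = decode t , decode x , proj₂ (∈-filter⁻ (T? ∘ decode) {xs = allFin v} x∈) , e

      blockOf∈ : ∀ t {x} → T x → blockOf t x List.∈ blocks
      blockOf∈ t {x} tx = subst₂ (λ t x → blockOf t x List.∈ blocks) (decode-encode t) (decode-encode x)
        (∈-cartesianProductWith⁺ _ (∈-allFin (encode t)) (∈-filter⁺ (T? ∘ decode) (∈-allFin (encode x)) (subst T (sym (decode-encode x)) tx)))

      size : ∀ {B} → B List.∈ blocks → ∣ B ∣ ≡ k
      size B∈ with ∈blocks B∈
      ... | t , x , tx , refl = ∣blockOf∣ t (T-nonzero tx)

      -- Represent the difference of `y` and `z` as `(b i - b j) ∙ x`. Placing `z` at position `j`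
      -- then forces the translation `t`.
      pair : ∀ y z → y ≢ z → ∃ λ B → B List.∈ blocks × y ∈ B × z ∈ B
      pair y z y≢z = through (represent d d≢𝟎)
        where
        d = neg (decode z) ⊞ decode y
        z⊞d≡y : decode z ⊞ d ≡ decode y
        z⊞d≡y = ⊞-neg-cancel (decode z) (decode y)
        d≢𝟎 : d ≢ 𝟎
        d≢𝟎 e = y≢z (decode-injective y z (trans (sym z⊞d≡y) (trans (cong (decode z ⊞_) e) (trans (⊞-comm (decode z) 𝟎) (⊞-identity (decode z))))))
        through : (∃₂ λ i j → ∃ λ x → i ≢ j × T x × d ≡ (b i - b j) ∙ x) → ∃ λ B → B List.∈ blocks × y ∈ B × z ∈ B
        through (i , j , x , i≢j , tx , d≡) = blockOf t x , blockOf∈ t tx ,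
            point∈ t x y i (trans (sym (encode-decode y)) (cong encode (trans (sym z⊞d≡y) (trans (cong₂ _⊞_ (sym tz) d≡) (move t i j x))))) ,
            point∈ t x z j (trans (sym (encode-decode z)) (cong encode (sym tz)))
          where
          t = neg (b j ∙ x) ⊞ decode z
          tz : t ⊞ b j ∙ x ≡ decode z
          tz = trans (⊞-comm t (b j ∙ x)) (⊞-neg-cancel (b j ∙ x) (decode z))

      -- The difference of the two points determines `i`, `j` and `x`; either point then determines
      -- the translation.
      unique : ∀ {B B′ y z} → B List.∈ blocks → B′ List.∈ blocks → y ≢ z → y ∈ B → z ∈ B → y ∈ B′ → z ∈ B′ → B ≡ B′
      unique {y = y} {z} B∈ B′∈ y≢z y∈ z∈ y∈′ z∈′ with ∈blocks B∈ | ∈blocks B′∈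
      ... | t , x , tx , refl | t′ , x′ , tx′ , refl with ∈⇒point {t} {x} y∈ | ∈⇒point {t} {x} z∈ | ∈⇒point {t′} {x′} y∈′ | ∈⇒point {t′} {x′} z∈′
      ...   | i , yi | j , zj | i′ , yi′ | j′ , zj′ = conclude (represent-unique i j i′ j′ x x′ (apart t x i j yi zj) (apart t′ x′ i′ j′ yi′ zj′) tx tx′
                (⊞-cancelˡ (t ⊞ b j ∙ x) (trans (move t i j x) (trans (encode-injective (t ⊞ b i ∙ x) (t′ ⊞ b i′ ∙ x′) (trans (sym yi) yi′))
                  (trans (sym (move t′ i′ j′ x′)) (cong (_⊞ (b i′ - b j′) ∙ x′) (encode-injective (t′ ⊞ b j′ ∙ x′) (t ⊞ b j ∙ x) (trans (sym zj′) zj))))))))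
        where
        apart : ∀ t x i j → y ≡ point t x i → z ≡ point t x j → i ≢ j
        apart t x i j p r refl = y≢z (trans p (sym r))
        conclude : i ≡ i′ × j ≡ j′ × x ≡ x′ → blockOf t x ≡ blockOf t′ x′
        conclude (refl , refl , refl) = cong (λ t → blockOf t x) (⊞-cancelˡ (b i ∙ x)
          (trans (⊞-comm (b i ∙ x) t) (trans (encode-injective (t ⊞ b i ∙ x) (t′ ⊞ b i ∙ x) (trans (sym yi) yi′)) (⊞-comm t′ (b i ∙ x)))))

      open DesignFromList blocks size pair unique public using (design)

      move-point : Fin n → Fin v → Fin v
      move-point g z = encode (act g (decode z))

      move-inverse : ∀ g h → (∀ x → act g (act h x) ≡ x) → ∀ z → move-point g (move-point h z) ≡ z
      move-inverse g h inverse z = trans (cong (encode ∘ act g) (decode-encode (act h (decode z)))) (trans (cong encode (inverse (decode z))) (encode-decode z))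

      φ : Fin n → Permutation′ v
      φ g = permutation (move-point g) (move-point (inv g)) (move-inverse g (inv g) (act-inv′ g)) (move-inverse (inv g) g (act-inv g))

      act-point : ∀ g t x i → act g (t ⊞ b i ∙ x) ≡ act g t ⊞ b i ∙ act g x
      act-point g t x i = trans (act-⊞ g t (b i ∙ x)) (cong (act g t ⊞_) (act-∙ g (b i) x))

      -- The action is linear, so it commutes with the scalars `b i`. Membership in an image is read
      -- at the inverse image of a point, so both directions pass through `act (inv g)`.
      image-block : ∀ g t x → image (φ g) (blockOf t x) ≡ blockOf (act g t) (act g x)
      image-block g t x = tabulate-cong λ z → trans (lookup∘tabulate _ (move-point (inv g) z))
        (does-⇔ (mk⇔ (λ (i , e) → i , to z i e) (λ (i , e) → i , from z i e)) (point? t x (move-point (inv g) z)) (point? (act g t) (act g x) z))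
        where
        to : ∀ z i → move-point (inv g) z ≡ point t x i → z ≡ point (act g t) (act g x) i
        to z i e = trans (sym (encode-decode z)) (cong encode (trans (sym (act-inv′ g (decode z)))
          (trans (cong (act g) (encode-injective (act (inv g) (decode z)) (t ⊞ b i ∙ x) e)) (act-point g t x i))))
        from : ∀ z i → z ≡ point (act g t) (act g x) i → move-point (inv g) z ≡ point t x i
        from z i e = cong encode (trans (cong (act (inv g)) (trans (cong decode e) (trans (decode-encode (act g t ⊞ b i ∙ act g x)) (sym (act-point g t x i)))))
          (act-inv g (t ⊞ b i ∙ x)))

      hasSubgroupIso : HasSubgroupIso design G
      hasSubgroupIso = φ , (λ g → DesignFromList.automorphism blocks size pair unique (φ g) (into g) (onto g)) , homomorphic , faithful
        where
        into : ∀ g {B} → B List.∈ blocks → image (φ g) B List.∈ blocks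
        into g B∈ with ∈blocks B∈
        ... | t , x , tx , refl = subst (List._∈ blocks) (sym (image-block g t x)) (blockOf∈ (act g t) (T-act g x tx))
        onto : ∀ g {B} → B List.∈ blocks → ∃ λ B′ → B′ List.∈ blocks × image (φ g) B′ ≡ B
        onto g B∈ with ∈blocks B∈
        ... | t , x , tx , refl = blockOf (act (inv g) t) (act (inv g) x) , blockOf∈ (act (inv g) t) (T-act (inv g) x tx) ,
          trans (image-block g (act (inv g) t) (act (inv g) x)) (cong₂ blockOf (act-inv′ g t) (act-inv′ g x))
        homomorphic : ∀ g h z → φ (g · h) ⟨$⟩ʳ z ≡ φ g ⟨$⟩ʳ (φ h ⟨$⟩ʳ z)
        homomorphic g h z = cong encode (trans (sym (act-act g h (decode z))) (cong (act g) (sym (decode-encode (act h (decode z))))))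
        faithful : ∀ g h → (∀ z → φ g ⟨$⟩ʳ z ≡ φ h ⟨$⟩ʳ z) → g ≡ h
        faithful g h same = act-faithful g h λ x → trans (cong (act g) (sym (decode-encode x)))
          (trans (encode-injective (act g (decode (encode x))) (act h (decode (encode x))) (same (encode x))) (cong (act h) (decode-encode x)))

-- Large prime fields of the required order, and the assembly of the design.

module PrimeFields where

  open PrimesInProgressions
  open FiniteFields
  open Counting
  open Cyclotomy
  open Representatives
  open Designs
  open import Defs
  open import Data.Nat as ℕ using (ℕ; zero; suc; NonZero)
  import Data.Nat.Properties as ℕ
  open import Data.Nat.Divisibility using (_∣_; divides; ∣⇒≤; m%n≡0⇒n∣m)
  open import Data.Nat.DivMod using (_/_; m≡m%n+[m/n]*n; m<n⇒m%n≡m; m*n%n≡0)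
  open import Data.Nat.Primality using (Prime; ¬prime[0]; prime⇒nonTrivial)
  open import Data.Nat.Tactic.RingSolver using (solve-∀)
  open import Data.Fin as Fin using (Fin)
  import Data.Fin.Properties as Fin
  open import Data.Product using (Σ; ∃; _×_; _,_; proj₁; proj₂)
  open import Data.Empty using (⊥-elim)
  open import Relation.Nullary using (¬_)
  open import Relation.Binary.Definitions using (tri<; tri≈; tri>)
  open import Relation.Binary.PropositionalEquality hiding ([_])

  module FromDifferences {k m q : ℕ} (ix : PairIndexing k m) (G : FiniteGroup) (odd-order : OddOrder G) (K : Field (suc q)) where

    open FieldTheory K
    private module Ix = PairIndexing ix

    module _ {e s t : ℕ} .{{m≢0 : NonZero m}} .{{e≢0 : NonZero e}} (2≢0 : 1# + 1# ≢ 0#)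
      (q≡me : q ≡ m ℕ.* e) (ns≡e : FiniteGroup.order G ℕ.* s ≡ e) (e≡2t : e ≡ 2 ℕ.* t) where

      open Classes m e q≡me

      module _ (b : Fin k → Fin (suc q)) (b< : ∀ i j → i Fin.< j → (b j - b i) ^ e ≡ w (Ix.class i j)) where

        private
          difference : ∀ i j → i ≢ j → (b i - b j) ^ e ≡ w (Ix.class i j)
          difference i j i≢j with Fin.<-cmp i j
          -- The differences were chosen with the larger index first; the sign disappears because
          -- `e` is even.
          ... | tri< i<j _ _ = trans (cong (_^ e) (neg-difference (b j) (b i))) (trans (^-distrib-* (- 1#) (b j - b i) e)
                  (trans (cong (_* (b j - b i) ^ e) (trans (cong ((- 1#) ^_) e≡2t) (-1^even t))) (trans (*-identityˡ _) (b< i j i<j))))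
          ... | tri≈ _ i≡j _ = ⊥-elim (i≢j i≡j)
          ... | tri> _ _ j<i = trans (b< j i j<i) (cong w (Ix.symmetric j i))

          module Tr = Transversal.Exponents.Differences K G odd-order 2≢0 m e s t q≡me ns≡e e≡2t b Ix.class difference Ix.unique Ix.onto
          module C = Construction.Translates K G b Tr.T Tr.T? Tr.T.nonzero Tr.T-act Tr.differ Tr.represent Tr.represent-unique

        design-from-differences : Σ (Design (suc q ℕ.^ FiniteGroup.order G) k) λ D → HasSubgroupIso D G
        design-from-differences = C.design , C.hasSubgroupIso

  -- Since 2 m n divides q, the number e = q / m is a multiple of 2 n.
  design-over-field : ∀ {k m q} → PairIndexing k m → .{{NonZero m}} → (G : FiniteGroup) → OddOrder G →
    .{{NonZero q}} → (K : Field (suc q)) (let open Field K) → 1# + 1# ≢ 0# → threshold m k 1 ℕ.≤ suc q →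
    2 ℕ.* m ℕ.* FiniteGroup.order G ∣ q → Σ (Design (suc q ℕ.^ FiniteGroup.order G) k) λ D → HasSubgroupIso D G
  design-over-field {k} {m} {q} ix G odd-order K 2≢0 big (divides r q≡) =
    FromDifferences.design-from-differences ix G odd-order K {s = 2 ℕ.* r} {t = n ℕ.* r} 2≢0 q≡me (n2r n r) refl (proj₁ differences) (proj₂ differences)
    where
    n = FiniteGroup.order G
    e = 2 ℕ.* (n ℕ.* r)
    shuffle : ∀ r m n → r ℕ.* (2 ℕ.* m ℕ.* n) ≡ m ℕ.* (2 ℕ.* (n ℕ.* r))
    shuffle = solve-∀
    n2r : ∀ n r → n ℕ.* (2 ℕ.* r) ≡ 2 ℕ.* (n ℕ.* r)
    n2r = solve-∀
    q≡me : q ≡ m ℕ.* e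
    q≡me = trans q≡ (shuffle r m n)
    instance
      e≢0 : NonZero e
      e≢0 = ℕ.m*n≢0⇒n≢0 m {{subst NonZero q≡me (ℕ.≢-nonZero (ℕ.≢-nonZero⁻¹ q))}}
    differences = FieldTheory.Classes.differences-in-classes K m e q≡me k (PairIndexing.class ix) big

  module PrimeField {p′ : ℕ} (pp : Prime (suc p′)) where

    open IntegersMod (suc p′) pp using (integersMod; [_]; []-*; []-+; []-injective)
    open FieldTheory integersMod

    [0]⇒∣ : ∀ m → [ m ] ≡ 0# → suc p′ ∣ m
    [0]⇒∣ m e = m%n≡0⇒n∣m m (suc p′) (trans ([]-injective {m} {0} e) (m*n%n≡0 0 (suc p′)))

    []-^ : ∀ b n → [ b ] ^ n ≡ [ b ℕ.^ n ]
    []-^ b zero = refl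
    []-^ b (suc n) = trans (cong ([ b ] *_) ([]-^ b n)) ([]-* b (b ℕ.^ n))

    -- Fermat's theorem, carried back from the field to the divisibility of natural numbers in which
    -- the order of `b` is expressed.
    ∣^-1 : ∀ b → ¬ (suc p′ ∣ b) → suc p′ ∣ ℕ.pred (b ℕ.^ p′)
    ∣^-1 b p∤b = divides (b ℕ.^ p′ / suc p′) (cong ℕ.pred (trans (m≡m%n+[m/n]*n (b ℕ.^ p′) (suc p′))
      (cong (ℕ._+ (b ℕ.^ p′ / suc p′) ℕ.* suc p′)
        (trans ([]-injective {b ℕ.^ p′} {1} (trans (sym ([]-^ b p′)) (fermat [ b ] (λ e → p∤b ([0]⇒∣ b e)))))
          (m<n⇒m%n≡m (ℕ.nonTrivial⇒n>1 (suc p′) {{prime⇒nonTrivial pp}}))))))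

    2≢0 : 2 ℕ.< suc p′ → 1# + 1# ≢ 0#
    2≢0 2<p e = ℕ.<⇒≱ 2<p (∣⇒≤ ([0]⇒∣ 2 (trans (sym ([]-+ 1 1)) e)))


  ∃-large-prime-field : ∀ M → .{{NonZero M}} → ∀ B → 2 ℕ.≤ B →
    ∃ λ q → B ℕ.≤ q × M ∣ q × Σ (Field (suc q)) λ K → let open Field K in 1# + 1# ≢ 0#
  ∃-large-prime-field M B 2≤B with ∃-large-prime-with-order M B
  ... | zero , pp , _ = ⊥-elim (¬prime[0] pp)
  ... | suc q , pp , B<p , b , p∤b , order =
    -- By Fermat the prime divides `b ^ q - 1`, so the order property at `N = q` yields `M ∣ q`.
    q , ℕ.≤-pred B<p , order q (∣^-1 b p∤b) , IntegersMod.integersMod (suc q) pp , 2≢0 (ℕ.≤-<-trans 2≤B B<p)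
    where open PrimeField pp

open import Defs
open import Data.Nat using (ℕ; suc; _+_; _*_; _^_; _≤_; _≥_; z<s; >-nonZero; >-nonZero⁻¹)
open import Data.Nat.Properties
  using (≤-trans; n≤1+n; m*n≢0; m≤m+n; m≤n+m; *-identityʳ; ^-monoʳ-≤)
open import Data.Fin.Properties using (nonZeroIndex)
open import Data.Product using (Σ; _×_; _,_)
open import Relation.Binary.PropositionalEquality using (subst)
open Counting using (threshold)
open Designs using (pair-indexing)
open PrimeFields using (∃-large-prime-field; design-over-field)

theorem2p2 : (k : ℕ) → k ≥ 3 → (G : FiniteGroup) → OddOrder G →
    (N : ℕ) → Σ ℕ λ v → (v ≥ N) × Σ (Design v k) λ D → HasSubgroupIso D G
theorem2p2 k k≥3 G odd-order N
  with m , m≢0 , ix ← pair-indexing k (≤-trans (n≤1+n 2) k≥3)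
  with q , B≤q , M∣q , K , 2≢0 ← ∃-large-prime-field (2 * m * FiniteGroup.order G)
         {{m*n≢0 (2 * m) (FiniteGroup.order G) {{m*n≢0 2 m {{_}} {{m≢0}}}} {{nonZeroIndex (FiniteGroup.e G)}}}}
         -- The summand 2 excludes characteristic 2, the threshold allows the `b i` to be chosen,
         -- and `N` makes the design large.
         (2 + (threshold m k 1 + N)) (m≤m+n 2 _)
  = suc q ^ FiniteGroup.order G , N≤v ,
    design-over-field ix {{m≢0}} G odd-order {{>-nonZero (≤-trans z<s B≤q)}} K 2≢0
      (≤-trans (m≤m+n _ N) bound) M∣q
  where
  bound : threshold m k 1 + N ≤ suc q
  bound = ≤-trans (m≤n+m _ 2) (≤-trans B≤q (n≤1+n q))
  -- G contains its identity, so the exponent is at least 1 and the number of points is at least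
  -- `suc q`.
  N≤v : N ≤ suc q ^ FiniteGroup.order G
  N≤v = ≤-trans (m≤n+m N _) (≤-trans bound (subst (_≤ suc q ^ FiniteGroup.order G) (*-identityʳ (suc q))
    (^-monoʳ-≤ (suc q) (>-nonZero⁻¹ _ {{nonZeroIndex (FiniteGroup.e G)}}))))
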